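{- Let $\mathbb{F}_q$ have prime characteristic $p$. For every integer $k \geq 1$, \[ \bigcup_{i=1}^k \{p^j : 0\le j\le t_i\}\, D(q^i-1) \subseteq P(k,\mathbb{F}_q), \] where $t_i = \lceil \log_p \lfloor k/i\rfloor\rceil = \min\{t\in\mathbb{Z} : p^t \ge \lfloor k/i\rfloor\}$ for $1\le i\le k$.
   Context: A sequence $\mathbf{a}=(a_n)_{n\ge 0}$ over $\mathbb{F}_q$ satisfies a linear recurrence of degree $k$ if there are $c_0,\dots,c_{k-1}\in\mathbb{F}_q$ with $c_0 \neq 0$ such that $a_{n+k}=\sum_{i=0}^{k-1}c_i a_{n+i}$ for all $n\ge 0$. Its period $\rho(\mathbf{a})$ is the least $m>0$ with $a_{n+m}=a_n$ for all sufficiently large $n$. $P(k,\mathbb{F}_q)$ denotes the set of periods $\rho(\mathbf{a})$ of all sequences over $\mathbb{F}_q$ satisfying a linear recurrence of degree $k$. For a positive integer $n$, $D(n)$ is the set of positive divisors of $n$. For sets $S_1,S_2\subseteq\mathbb{Z}$, $S_1S_2=\{xy : x\in S_1, y\in S_2\}$. -}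

module Defs where

open import Level using (0ℓ)
open import Data.Nat using (ℕ; zero; suc)
import Data.Nat as N
open import Data.Fin using (Fin)
import Data.Fin as Fn
open import Data.Product using (Σ; _×_; ∃)
open import Relation.Nullary using (¬_)
open import Relation.Binary.PropositionalEquality using (_≡_)
open import Algebra.Bundles using (CommutativeRing)

record FiniteField : Set₁ where
  field
    cring : CommutativeRing 0ℓ 0ℓ
  open CommutativeRing cring public
  field
    size     : ℕ
    0≉1      : ¬ (0# ≈ 1#)
    inverse  : ∀ x → ¬ (x ≈ 0#) → Σ Carrier (λ y → (x * y) ≈ 1#)
    enum     : Fin size → Carrier
    enum-inj : ∀ a b → enum a ≈ enum b → a ≡ b
    enum-sur : ∀ x → Σ (Fin size) (λ a → enum a ≈ x)

module _ (F : FiniteField) where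
  open FiniteField F

  natMul : ℕ → Carrier
  natMul zero    = 0#
  natMul (suc n) = 1# + natMul n

  HasChar : ℕ → Set
  HasChar p = natMul p ≈ 0#

  sumF : (n : ℕ) → (Fin n → Carrier) → Carrier
  sumF zero    f = 0#
  sumF (suc n) f = f Fn.zero + sumF n (λ i → f (Fn.suc i))

  LinRec : (k : ℕ) → (ℕ → Carrier) → (Fin k → Carrier) → Set
  LinRec k a c = ∀ n → a (n N.+ k) ≈ sumF k (λ i → c i * a (n N.+ Fn.toℕ i))

  IsEventualPeriod : (ℕ → Carrier) → ℕ → Set
  IsEventualPeriod a m = (0 N.< m) × ∃ (λ N → ∀ n → N N.≤ n → a (n N.+ m) ≈ a n)

  PeriodIs : (ℕ → Carrier) → ℕ → Set
  PeriodIs a m = IsEventualPeriod a m × (∀ m' → IsEventualPeriod a m' → m N.≤ m')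

  InP : ℕ → ℕ → Set
  InP k m = Σ (ℕ → Carrier) λ a → Σ (Fin k → Carrier) λ c →
              (∀ (z : Fin k) → Fn.toℕ z ≡ 0 → ¬ (c z ≈ 0#)) ×
              LinRec k a c × PeriodIs a m

{-# OPTIONS --safe #-}
-- Put q = |F|. Over F the polynomial X^d − 1 is separable, and it does not divide the product Φ
-- of the X^(d/ℓ) − 1 over the primes ℓ ∣ d. Hence it has an irreducible factor f that does not
-- divide Φ, i.e. modulo f the class of X has order exactly d. Since d ∣ q^i − 1, every element
-- of F[X]/f is a root of T^(q^i) − T, so q^(deg f) ≤ q^i and deg f ≤ i. By separability and
-- Frobenius, f divides X^(p^b n) − 1 = (X^n − 1)^(p^b), where p ∤ n and d ∣ n, with multiplicity
-- exactly p^b. So for s = 1 (if j = 0) or s = p^(j−1) + 1, the least m with f^s ∣ X^m − 1 is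
-- p^j d, and s · deg f ≤ k. This m is the period of the impulse response of f^s, which also
-- satisfies the degree k recurrence given by f^s (X − 1)^(k − s · deg f).
module Submission where

open import Defs
open import Level using (0ℓ)
open import Algebra.Bundles using (CommutativeRing; RawRing)
open import Data.Nat as ℕ using (ℕ; zero; suc; _∸_; _/_; NonZero)
import Data.Nat.Properties as ℕₚ
import Data.Nat.Divisibility as ℕ∣
open import Data.Nat.Divisibility using () renaming (_∣_ to _ℕ∣_)
open import Data.Nat.Combinatorics using (nCn≡1; nCk≡n!/k![n-k]!; k![n∸k]!∣n!) renaming (_C_ to _choose_)
open import Data.Nat.DivMod using (m/n*n≡m; m/n*n≤m)
open import Data.Nat.GCD using (gcd; gcd-GCD; gcd[m,n]∣m; gcd[m,n]∣n; module Bézout)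
open import Data.Nat.Induction using (<-rec)
open import Data.Nat.ListAction using (product)
open import Data.Nat.Primality using (Prime; prime?; euclidsLemma; prime⇒nonZero; prime⇒nonTrivial; prime⇒irreducible)
open import Data.Nat.Primality.Factorisation using (factorise)
open import Data.Empty using (⊥-elim)
open import Data.Fin as Fin using (Fin)
import Data.Fin.Properties as Finₚ
open import Data.Fin.Permutation using (Permutation; permutation)
open import Data.List as List using (List; []; _∷_; length)
import Data.List.Properties as Listₚ
import Data.List.Relation.Unary.All as ListAll
open import Data.Maybe using (Maybe; just; nothing)
open import Data.Product using (_×_; _,_; proj₁; proj₂; Σ; ∃; ∃₂)
open import Data.Sum using (_⊎_; inj₁; inj₂)
open import Data.Vec as Vec using (Vec; []; _∷_; _∷ʳ_; zipWith; toList; initLast; head; tail)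
open import Data.Vec.Properties using (length-toList)
open import Data.Vec.Functional using (removeAt)
open import Data.Vec.Relation.Binary.Pointwise.Inductive as Pointwise using (Pointwise; []; _∷_)
open import Data.Vec.Relation.Unary.All using (All; []; _∷_; all?)
open import Function using (_∘_)
import Relation.Binary.PropositionalEquality as ≡
open ≡ using (_≡_)
open import Relation.Nullary using (¬_; yes; no; Dec; _×-dec_)
import Relation.Nullary.Decidable as Dec

-- The obstacle is a degree theory for coefficient lists, which may end in zeros. It is drawn from
-- recurrences: a polynomial is an operator on sequences, a monic polynomial acts surjectively
-- because its recurrence can be solved, and in positive degree e its impulse response 0, ..., 0, 1,
-- ... is annihilated exactly by its multiples and by no nonzero polynomial with at most e
-- coefficients. Cancellation, comparison of degrees and uniqueness of remainders follow, and the
-- same sequence finally realises the period. Tests on sequences also show that X^d - 1 does not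
-- divide Φ and extract constant terms. Separability rests on the Euler derivation X · d/dX, which
-- sends X^m - 1 to m X^m. Additivity of T ↦ T^q modulo f comes from counting roots, with the q
-- constants as roots. The degree of f can be smaller than i, when d already divides q^e - 1 for
-- some e < i; this is one reason for padding the recurrence up to degree k.

-- The integers as formal differences (a , b) = a − b of naturals; this makes
-- cancellation visible to the ring solver over an arbitrary commutative ring.
module DifferenceSolver (R : CommutativeRing 0ℓ 0ℓ) where
  open CommutativeRing R
  open import Algebra.Solver.Ring.AlmostCommutativeRing
  open import Algebra.Properties.Semiring.Mult.TCOptimised semiring
    using (×1-homo-*; ×-homo-+) renaming (_×_ to _·_)
  open import Algebra.Properties.Ring ring using (-‿distribˡ-*; -‿distribʳ-*; -0#≈0#)
  open import Algebra.Properties.AbelianGroup +-abelianGroup using (⁻¹-∙-comm; ⁻¹-involutive)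
  open import Relation.Binary.Reasoning.Setoid setoid
  import Algebra.Solver.Ring.NaturalCoefficients.Default commutativeSemiring as NS

  private
    reduce : ℕ → ℕ → ℕ × ℕ
    reduce zero    b       = 0 , b
    reduce (suc a) zero    = suc a , 0
    reduce (suc a) (suc b) = reduce a b

    differences : RawRing 0ℓ 0ℓ
    differences = record
      { Carrier = ℕ × ℕ
      ; _≈_ = _≡_
      ; _+_ = λ { (a , b) (c , d) → reduce (a ℕ.+ c) (b ℕ.+ d) }
      ; _*_ = λ { (a , b) (c , d) → reduce (a ℕ.* c ℕ.+ b ℕ.* d) (a ℕ.* d ℕ.+ b ℕ.* c) }
      ; -_ = λ { (a , b) → b , a }
      ; 0# = 0 , 0
      ; 1# = 1 , 0
      }

    -- Splitting off b = 0 lets `0 , 0` and `1 , 0` evaluate definitionally to `0#` and `1#`, so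
    -- that `:0` and `:1` match these terms literally.
    ⟦_⟧ : ℕ × ℕ → Carrier
    ⟦ a , zero ⟧      = a · 1#
    ⟦ a , b@(suc _) ⟧ = a · 1# - b · 1#

    ⟦⟧-difference : ∀ a b → ⟦ a , b ⟧ ≈ a · 1# - b · 1#
    ⟦⟧-difference a zero    = sym (trans (+-congˡ -0#≈0#) (+-identityʳ _))
    ⟦⟧-difference a (suc b) = refl

    ⟦⟧-cong : ∀ a b c d → a ℕ.+ d ≡ c ℕ.+ b → ⟦ a , b ⟧ ≈ ⟦ c , d ⟧
    ⟦⟧-cong a b c d eq = begin
      ⟦ a , b ⟧                      ≈⟨ ⟦⟧-difference a b ⟩
      A - B                          ≈⟨ sym (trans (+-congˡ (-‿inverseʳ D)) (+-identityʳ _)) ⟩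
      (A - B) + (D - D)              ≈⟨ shuffle A (- B) D (- D) ⟩
      (A + D) + (- B - D)            ≈⟨ +-congʳ (trans (sym (×-homo-+ 1# a d)) (trans (reflexive (≡.cong (_· 1#) eq)) (×-homo-+ 1# c b))) ⟩
      (C + B) + (- B - D)            ≈⟨ shuffle′ C B (- B) (- D) ⟩
      (C - D) + (B - B)              ≈⟨ trans (+-congˡ (-‿inverseʳ B)) (+-identityʳ _) ⟩
      C - D                          ≈⟨ ⟦⟧-difference c d ⟨
      ⟦ c , d ⟧                      ∎
      where
      A = a · 1#
      B = b · 1#
      C = c · 1#
      D = d · 1#
      shuffle : ∀ w x y z → (w + x) + (y + z) ≈ (w + y) + (x + z)
      shuffle = NS.solve 4 (λ w x y z → (w NS.:+ x) NS.:+ (y NS.:+ z) NS.:= (w NS.:+ y) NS.:+ (x NS.:+ z)) refl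
      shuffle′ : ∀ w x y z → (w + x) + (y + z) ≈ (w + z) + (x + y)
      shuffle′ = NS.solve 4 (λ w x y z → (w NS.:+ x) NS.:+ (y NS.:+ z) NS.:= (w NS.:+ z) NS.:+ (x NS.:+ y)) refl

    ⟦⟧-reduce : ∀ a b → ⟦ reduce a b ⟧ ≈ ⟦ a , b ⟧
    ⟦⟧-reduce zero    b       = refl
    ⟦⟧-reduce (suc a) zero    = refl
    ⟦⟧-reduce (suc a) (suc b) = trans (⟦⟧-reduce a b) (⟦⟧-cong a b (suc a) (suc b) (ℕₚ.+-suc a b))

    ⟦⟧-+ : ∀ x y → ⟦ RawRing._+_ differences x y ⟧ ≈ ⟦ x ⟧ + ⟦ y ⟧
    ⟦⟧-+ (a , b) (c , d) = begin
      ⟦ reduce (a ℕ.+ c) (b ℕ.+ d) ⟧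
        ≈⟨ ⟦⟧-reduce (a ℕ.+ c) (b ℕ.+ d) ⟩
      ⟦ a ℕ.+ c , b ℕ.+ d ⟧
        ≈⟨ ⟦⟧-difference (a ℕ.+ c) (b ℕ.+ d) ⟩
      (a ℕ.+ c) · 1# - (b ℕ.+ d) · 1#
        ≈⟨ +-cong (×-homo-+ 1# a c) (-‿cong (×-homo-+ 1# b d)) ⟩
      (a · 1# + c · 1#) - (b · 1# + d · 1#)
        ≈⟨ +-congˡ (sym (⁻¹-∙-comm _ _)) ⟩
      (a · 1# + c · 1#) + (- (b · 1#) + - (d · 1#))
        ≈⟨ NS.solve 4 (λ w x y z → (w NS.:+ x) NS.:+ (y NS.:+ z) NS.:= (w NS.:+ y) NS.:+ (x NS.:+ z)) refl _ _ _ _ ⟩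
      (a · 1# - b · 1#) + (c · 1# - d · 1#)
        ≈⟨ +-cong (⟦⟧-difference a b) (⟦⟧-difference c d) ⟨
      ⟦ a , b ⟧ + ⟦ c , d ⟧ ∎

    ⟦⟧-* : ∀ x y → ⟦ RawRing._*_ differences x y ⟧ ≈ ⟦ x ⟧ * ⟦ y ⟧
    ⟦⟧-* (a , b) (c , d) = begin
      ⟦ reduce (a ℕ.* c ℕ.+ b ℕ.* d) (a ℕ.* d ℕ.+ b ℕ.* c) ⟧
        ≈⟨ ⟦⟧-reduce (a ℕ.* c ℕ.+ b ℕ.* d) (a ℕ.* d ℕ.+ b ℕ.* c) ⟩
      ⟦ a ℕ.* c ℕ.+ b ℕ.* d , a ℕ.* d ℕ.+ b ℕ.* c ⟧
        ≈⟨ ⟦⟧-difference (a ℕ.* c ℕ.+ b ℕ.* d) (a ℕ.* d ℕ.+ b ℕ.* c) ⟩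
      (a ℕ.* c ℕ.+ b ℕ.* d) · 1# - (a ℕ.* d ℕ.+ b ℕ.* c) · 1#
        ≈⟨ +-cong (products a c b d) (-‿cong (products a d b c)) ⟩
      (A * C + B * D) - (A * D + B * C)
        ≈⟨ +-cong (+-congˡ (sym -B*-D)) (trans (sym (⁻¹-∙-comm _ _)) (+-cong (-‿distribʳ-* A D) (-‿distribˡ-* B C))) ⟩
      (A * C + - B * - D) + (A * - D + - B * C)
        ≈⟨ NS.solve 4 (λ w x y z → (w NS.:* y NS.:+ x NS.:* z) NS.:+ (w NS.:* z NS.:+ x NS.:* y)
                         NS.:= (w NS.:+ x) NS.:* (y NS.:+ z)) refl A (- B) C (- D) ⟩
      (A - B) * (C - D)
        ≈⟨ *-cong (⟦⟧-difference a b) (⟦⟧-difference c d) ⟨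
      ⟦ a , b ⟧ * ⟦ c , d ⟧ ∎
      where
      A = a · 1#
      B = b · 1#
      C = c · 1#
      D = d · 1#
      -B*-D : - B * - D ≈ B * D
      -B*-D = trans (sym (-‿distribˡ-* B (- D))) (trans (-‿cong (sym (-‿distribʳ-* B D))) (⁻¹-involutive _))
      products : ∀ s t u v → (s ℕ.* t ℕ.+ u ℕ.* v) · 1# ≈ (s · 1#) * (t · 1#) + (u · 1#) * (v · 1#)
      products s t u v = trans (×-homo-+ 1# (s ℕ.* t) (u ℕ.* v)) (+-cong (×1-homo-* s t) (×1-homo-* u v))

    ⟦⟧-neg : ∀ x → ⟦ RawRing.-_ differences x ⟧ ≈ - ⟦ x ⟧
    ⟦⟧-neg (a , b) = begin
      ⟦ b , a ⟧              ≈⟨ ⟦⟧-difference b a ⟩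
      b · 1# - a · 1#        ≈⟨ +-comm _ _ ⟩
      - (a · 1#) + b · 1#    ≈⟨ +-congˡ (sym (⁻¹-involutive _)) ⟩
      - (a · 1#) - - (b · 1#) ≈⟨ ⁻¹-∙-comm _ _ ⟩
      - (a · 1# - b · 1#)    ≈⟨ -‿cong (⟦⟧-difference a b) ⟨
      - ⟦ a , b ⟧            ∎

    morphism : differences -Raw-AlmostCommutative⟶ fromCommutativeRing R
    morphism = record
      { ⟦_⟧ = ⟦_⟧ ; +-homo = ⟦⟧-+ ; *-homo = ⟦⟧-* ; -‿homo = ⟦⟧-neg ; 0-homo = refl ; 1-homo = refl }

    _≟_ : ∀ x y → Maybe (⟦ x ⟧ ≈ ⟦ y ⟧)
    (a , b) ≟ (c , d) with (a ℕ.+ d) ℕ.≟ (c ℕ.+ b)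
    ... | yes eq = just (⟦⟧-cong a b c d eq)
    ... | no  _  = nothing

  open import Algebra.Solver.Ring differences (fromCommutativeRing R) morphism _≟_ public
    using (Polynomial; solve; _:=_; _:+_; _:*_; _:-_; :-_; con)

  :1 : ∀ {n} → Polynomial n
  :1 = con (1 , 0)

  :0 : ∀ {n} → Polynomial n
  :0 = con (0 , 0)

-- Binomial coefficients modulo a prime

prime∣!⇒≤ : ∀ {p} → Prime p → ∀ k → p ℕ∣ k ℕ.! → p ℕ.≤ k
prime∣!⇒≤ {p} pr zero    p∣1 = ⊥-elim (ℕₚ.<⇒≱ (ℕ.nonTrivial⇒n>1 p {{prime⇒nonTrivial pr}}) (ℕ∣.∣⇒≤ p∣1))
prime∣!⇒≤ pr (suc k) p∣ with euclidsLemma (suc k) (k ℕ.!) pr p∣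
... | inj₁ p∣k+1 = ℕ∣.∣⇒≤ p∣k+1
... | inj₂ p∣k!  = ℕₚ.m≤n⇒m≤1+n (prime∣!⇒≤ pr k p∣k!)

-- p divides p! = C(p, k+1) · (k+1)! · (p-k-1)! but neither factorial, since both arguments lie
-- below p.
prime∣C : ∀ {p} → Prime p → ∀ k → suc k ℕ.< p → p ℕ∣ (p choose suc k)
prime∣C {p} pr k k<p with euclidsLemma (p choose suc k) _ pr p∣product
  where
  instance _ = suc k ℕₚ.!* (p ℕ.∸ suc k) !≢0
  product≡ : (p choose suc k) ℕ.* (suc k ℕ.! ℕ.* (p ℕ.∸ suc k) ℕ.!) ≡ p ℕ.!
  product≡ = ≡.trans (≡.cong (ℕ._* (suc k ℕ.! ℕ.* (p ℕ.∸ suc k) ℕ.!)) (nCk≡n!/k![n-k]! (ℕₚ.<⇒≤ k<p)))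
                     (m/n*n≡m (k![n∸k]!∣n! (ℕₚ.<⇒≤ k<p)))
  p∣p! : ∀ n → Prime n → n ℕ∣ n ℕ.!
  p∣p! zero    pr′ = ⊥-elim (ℕ.≢-nonZero⁻¹ 0 {{prime⇒nonZero pr′}} ≡.refl)
  p∣p! (suc n) _   = ℕ∣.m∣m*n (n ℕ.!)
  p∣product = ≡.subst (p ℕ∣_) (≡.sym product≡) (p∣p! p pr)
... | inj₁ p∣C = p∣C
... | inj₂ p∣k!* with euclidsLemma (suc k ℕ.!) _ pr p∣k!*
...   | inj₁ p∣k! = ⊥-elim (ℕₚ.<⇒≱ k<p (prime∣!⇒≤ pr (suc k) p∣k!))
...   | inj₂ p∣   = ⊥-elim (ℕₚ.<⇒≱ (p∸<p k<p) (prime∣!⇒≤ pr _ p∣))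
  where
  p∸<p : suc k ℕ.< p → p ℕ.∸ suc k ℕ.< p
  p∸<p (ℕ.s≤s q) = ℕ.s≤s (ℕₚ.m∸n≤m _ k)

-- Divisibility, coprimality, Frobenius and quotients in commutative rings

module RingTheory (R : CommutativeRing 0ℓ 0ℓ) where
  open CommutativeRing R
  open DifferenceSolver R
  open import Algebra.Definitions.RawMagma *-rawMagma public using (_∣_; _,_)
  open import Algebra.Properties.Monoid.Divisibility *-monoid public
    using () renaming (∣ʳ-refl to ∣-refl; ∣ʳ-trans to ∣-trans; ∣ʳ-respʳ-≈ to ∣-respʳ; x∣ʳy⇒x∣ʳzy to ∣-*ˡ)
  open import Algebra.Properties.Semiring.Mult semiring using (×-assocˡ; ×-congʳ; ×-assoc-*) renaming (_×_ to _·_)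
  open import Algebra.Properties.CommutativeSemiring.Exp commutativeSemiring public
  open import Algebra.Properties.Semiring.Sum semiring using (sum; sum-cong-≋; sum-replicate-zero; sum-init-last)
  import Algebra.Properties.CommutativeSemiring.Binomial commutativeSemiring as Binomial
  open import Relation.Binary.Reasoning.Setoid setoid

  ∣-+ : ∀ {f a b} → f ∣ a → f ∣ b → f ∣ a + b
  ∣-+ (g , eq) (h , eq′) = g + h , trans (distribʳ _ _ _) (+-cong eq eq′)

  ∣-neg : ∀ {f a} → f ∣ a → f ∣ - a
  ∣-neg {f} (g , eq) = - g , trans (solve 2 (λ g f → (:- g) :* f := :- (g :* f)) refl g f) (-‿cong eq)

  ∣-*ʳ : ∀ {f a} c → f ∣ a → f ∣ a * c
  ∣-*ʳ c f∣a = ∣-respʳ (*-comm _ _) (∣-*ˡ c f∣a)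

  ∣-pow : ∀ {f a} n → f ∣ a → f ^ n ∣ a ^ n
  ∣-pow n (h , eq) = h ^ n , trans (sym (^-distrib-* _ _ n)) (^-congˡ n eq)

  Coprime : Carrier → Carrier → Set
  Coprime f g = ∃₂ λ a b → a * f + b * g ≈ 1#

  -- Multiplying a f + b g = 1 by g^n gives g^n = a f g^n + b g^(n+1), so divisibility by f descends
  -- from g^(n+1) to g^n and finally to 1.
  coprime∣^⇒∣1 : ∀ {f g} n → Coprime f g → f ∣ g ^ n → f ∣ 1#
  coprime∣^⇒∣1 zero    _ f∣ = f∣
  coprime∣^⇒∣1 {f} {g} (suc n) c@(a , b , eq) f∣ = coprime∣^⇒∣1 n c
    (∣-respʳ step (∣-+ (g ^ n * a , refl) (∣-*ˡ b f∣)))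
    where
    step : (g ^ n * a) * f + b * (g * g ^ n) ≈ g ^ n
    step = trans (solve 5 (λ a b f g h → (h :* a) :* f :+ b :* (g :* h) := (a :* f :+ b :* g) :* h) refl a b f g (g ^ n))
                 (trans (*-congʳ eq) (*-identityˡ _))

  coprime-product∣ : ∀ {f g a} → Coprime f g → f ∣ a → g ∣ a → f * g ∣ a
  coprime-product∣ {f} {g} {a} (s , t , eq) (u , uf≈a) (v , vg≈a) = s * v + t * u , (begin
    (s * v + t * u) * (f * g)          ≈⟨ solve 6 (λ s t u v f g → (s :* v :+ t :* u) :* (f :* g)
                                            := (s :* f) :* (v :* g) :+ (t :* g) :* (u :* f)) refl s t u v f g ⟩
    (s * f) * (v * g) + (t * g) * (u * f) ≈⟨ +-cong (*-congˡ vg≈a) (*-congˡ uf≈a) ⟩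
    (s * f) * a + (t * g) * a          ≈⟨ distribʳ _ _ _ ⟨
    (s * f + t * g) * a                ≈⟨ *-congʳ eq ⟩
    1# * a                             ≈⟨ *-identityˡ a ⟩
    a                                  ∎)

  coprime-*ʳ : ∀ {f g h} → Coprime f (g * h) → Coprime f g
  coprime-*ʳ {f} {g} {h} (a , b , eq) =
    a , b * h , trans (+-congˡ (solve 3 (λ b h g → (b :* h) :* g := b :* (g :* h)) refl b h g)) eq

  -- For a derivation D with D X = ν X, this applies to f′ = D f and g′ = D g.
  leibniz⇒coprime : ∀ {f g f′ g′ X ν ν⁻¹} → f * g ≈ X - 1# → f′ * g + f * g′ ≈ ν * X →
                    ν⁻¹ * ν ≈ 1# → Coprime f g
  leibniz⇒coprime {f} {g} {f′} {g′} {X} {ν} {ν⁻¹} fg≈ leib inv =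
    ν⁻¹ * (g′ - ν * g) , ν⁻¹ * f′ , (begin
      (ν⁻¹ * (g′ - ν * g)) * f + (ν⁻¹ * f′) * g
        ≈⟨ solve 6 (λ i ν f g f′ g′ → (i :* (g′ :- ν :* g)) :* f :+ (i :* f′) :* g
             := i :* ((f′ :* g :+ f :* g′) :- ν :* (f :* g))) refl ν⁻¹ ν f g f′ g′ ⟩
      ν⁻¹ * ((f′ * g + f * g′) - ν * (f * g))
        ≈⟨ *-congˡ (+-cong leib (-‿cong (*-congˡ fg≈))) ⟩
      ν⁻¹ * (ν * X - ν * (X - 1#))
        ≈⟨ solve 3 (λ i ν X → i :* (ν :* X :- ν :* (X :- :1)) := i :* ν) refl ν⁻¹ ν X ⟩
      ν⁻¹ * ν
        ≈⟨ inv ⟩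
      1# ∎)

  quotient-remainder⇒∣ : ∀ {f p q r} → p ≈ q * f + r → r ≈ 0# → f ∣ p
  quotient-remainder⇒∣ {q = q} p≈ r≈0 = q , sym (trans p≈ (trans (+-congˡ r≈0) (+-identityʳ _)))

  ∣-remainder : ∀ {f p q r} → p ≈ q * f + r → f ∣ p → f ∣ r
  ∣-remainder {f} {p} {q} {r} p≈ f∣p = ∣-respʳ
    (trans (+-congʳ p≈) (solve 2 (λ a r → (a :+ r) :- a := r) refl (q * f) r))
    (∣-+ f∣p (∣-neg (q , refl)))

  -- One Horner step of making a polynomial monic: a unit t in front of the tail m comes out of the
  -- whole sum once c is replaced by u c.
  factor-unit : ∀ {t u} c x m → u * t ≈ 1# → c + x * (t * m) ≈ t * (u * c + x * m)
  factor-unit {t} {u} c x m ut≈1 = sym (trans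
    (solve 5 (λ t u c x m → t :* (u :* c :+ x :* m) := (u :* t) :* c :+ x :* (t :* m)) refl t u c x m)
    (+-congʳ (trans (*-congʳ ut≈1) (*-identityˡ c))))

  refactor : ∀ {t h a b v} → h ≈ t * b → h * a ≈ v → t * (a * b) ≈ v
  refactor {t} {h} {a} {b} h≈ ha≈v =
    trans (solve 3 (λ t a b → t :* (a :* b) := (t :* b) :* a) refl t a b) (trans (*-congʳ (sym h≈)) ha≈v)

  unit-multiple-∣ : ∀ {t u a v} → u * t ≈ 1# → t * a ≈ v → v ∣ a
  unit-multiple-∣ {t} {u} {a} ut≈1 ta≈v =
    u , trans (*-congˡ (sym ta≈v)) (trans (sym (*-assoc u t a)) (trans (*-congʳ ut≈1) (*-identityˡ a)))

  -- A step of the Euclidean algorithm.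
  inverse-from-remainder : ∀ {f q w t w′ u y} → f ≈ q * w + t * w′ → u * t ≈ 1# → f ∣ w′ * y - 1# →
                           f ∣ w * - (u * q * y) - 1#
  inverse-from-remainder {f} {q} {w} {t} {w′} {u} {y} f≈ ut≈1 d =
    ∣-respʳ (begin
      (w′ * y - 1#) + - (u * y) * f
        ≈⟨ +-congˡ (*-congˡ f≈) ⟩
      (w′ * y - 1#) + - (u * y) * (q * w + t * w′)
        ≈⟨ solve 6 (λ w w′ y u t q → (w′ :* y :- :1) :+ (:- (u :* y)) :* (q :* w :+ t :* w′)
             := (w :* (:- (u :* q :* y)) :- :1) :+ (w′ :* y) :* (:1 :- u :* t)) refl w w′ y u t q ⟩
      (w * - (u * q * y) - 1#) + (w′ * y) * (1# - u * t)
        ≈⟨ +-congˡ (*-congˡ (+-congˡ (-‿cong ut≈1))) ⟩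
      (w * - (u * q * y) - 1#) + (w′ * y) * (1# - 1#)
        ≈⟨ solve 2 (λ a b → a :+ b :* (:1 :- :1) := a) refl _ (w′ * y) ⟩
      w * - (u * q * y) - 1# ∎) (∣-+ d (- (u * y) , refl))

  inverse-mod : ∀ {f p q t w u y} → p ≈ q * f + t * w → u * t ≈ 1# → f ∣ w * y - 1# → f ∣ p * (u * y) - 1#
  inverse-mod {f} {p} {q} {t} {w} {u} {y} p≈ ut≈1 d =
    ∣-respʳ (sym (begin
      p * (u * y) - 1#
        ≈⟨ +-congʳ (*-congʳ p≈) ⟩
      (q * f + t * w) * (u * y) - 1#
        ≈⟨ solve 6 (λ w y u t q f → (q :* f :+ t :* w) :* (u :* y) :- :1
             := ((w :* y :- :1) :+ (q :* u :* y) :* f) :+ (w :* y) :* (u :* t :- :1)) refl w y u t q f ⟩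
      ((w * y - 1#) + (q * u * y) * f) + (w * y) * (u * t - 1#)
        ≈⟨ +-congˡ (*-congˡ (+-congʳ ut≈1)) ⟩
      ((w * y - 1#) + (q * u * y) * f) + (w * y) * (1# - 1#)
        ≈⟨ solve 2 (λ a b → a :+ b :* (:1 :- :1) := a) refl _ (w * y) ⟩
      (w * y - 1#) + (q * u * y) * f ∎)) (∣-+ d (q * u * y , refl))

  1-inverse : ∀ {f} → f ∣ 1# * 1# - 1#
  1-inverse {f} = 0# , solve 1 (λ f → :0 :* f := :1 :* :1 :- :1) refl f

  ≈⇒∣- : ∀ {f a b} → a ≈ b → f ∣ a - b
  ≈⇒∣- {f} {a} {b} a≈b = 0# , trans (zeroˡ f) (sym (trans (+-congʳ a≈b) (-‿inverseʳ b)))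

  ∣-0 : ∀ {f a} → f ∣ a - 0# → f ∣ a
  ∣-0 {f} {a} = ∣-respʳ (solve 1 (λ a → a :- :0 := a) refl a)

  ∣⇒∣-0 : ∀ {f a} → f ∣ a → f ∣ a - 0#
  ∣⇒∣-0 {f} {a} = ∣-respʳ (solve 1 (λ a → a := a :- :0) refl a)

  module Frobenius {p} (pr : Prime p) (p≈0 : p · 1# ≈ 0#) where

    ∣⇒·≈0 : ∀ {n} z → p ℕ∣ n → n · z ≈ 0#
    ∣⇒·≈0 z (ℕ∣.divides m ≡.refl) = begin
      (m ℕ.* p) · z        ≈⟨ ×-assocˡ z m p ⟨
      m · (p · z)          ≈⟨ ×-congʳ m (×-congʳ p (sym (*-identityˡ z))) ⟩
      m · (p · (1# * z))   ≈⟨ ×-congʳ m (sym (×-assoc-* p 1# z)) ⟩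
      m · ((p · 1#) * z)   ≈⟨ ×-congʳ m (trans (*-congʳ p≈0) (zeroˡ z)) ⟩
      m · 0#               ≈⟨ m·0 m ⟩
      0#                   ∎
      where
      m·0 : ∀ m → m · 0# ≈ 0#
      m·0 zero    = refl
      m·0 (suc m) = trans (+-identityˡ _) (m·0 m)

    ^p-homo-+ : ∀ x y → (x + y) ^ p ≈ x ^ p + y ^ p
    ^p-homo-+ x y = helper p ≡.refl
      where
      -- A variable n with n ≡ p can be matched as a successor, which lets the first and the last
      -- binomial term be split off.
      helper : ∀ n → n ≡ p → (x + y) ^ n ≈ x ^ n + y ^ n
      helper zero    eq = ⊥-elim (ℕ.≢-nonZero⁻¹ p {{prime⇒nonZero pr}} (≡.sym eq))
      helper (suc n) eq = begin
        (x + y) ^ suc n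
          ≈⟨ Binomial.theorem (suc n) x y ⟩
        t Fin.zero + sum (λ k → t (Fin.suc k))
          ≈⟨ +-congˡ (sum-init-last (λ k → t (Fin.suc k))) ⟩
        t Fin.zero + (sum (λ k → t (Fin.suc (Fin.inject₁ k))) + t (Fin.suc (Fin.fromℕ n)))
          ≈⟨ +-cong first (+-cong (trans (sum-cong-≋ middle) (sum-replicate-zero n)) last) ⟩
        y ^ suc n + (0# + x ^ suc n)
          ≈⟨ solve 2 (λ a b → b :+ (:0 :+ a) := a :+ b) refl (x ^ suc n) (y ^ suc n) ⟩
        x ^ suc n + y ^ suc n ∎
        where
        t = Binomial.binomialTerm x y (suc n)
        first : t Fin.zero ≈ y ^ suc n
        first = solve 1 (λ a → :1 :* a :+ :0 := a) refl (y ^ suc n)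
        middle : ∀ k → t (Fin.suc (Fin.inject₁ k)) ≈ 0#
        middle k = ∣⇒·≈0 _ (≡.subst (λ m → p ℕ∣ (m choose suc (Fin.toℕ (Fin.inject₁ k)))) (≡.sym eq)
          (prime∣C pr _ (≡.subst (suc (Fin.toℕ (Fin.inject₁ k)) ℕ.<_) eq (ℕ.s≤s (Finₚ.inject₁ℕ< k)))))
        last : t (Fin.suc (Fin.fromℕ n)) ≈ x ^ suc n
        last rewrite Finₚ.toℕ-fromℕ n | nCn≡1 (suc n) | ℕₚ.n∸n≡0 n =
          solve 1 (λ a → a :* :1 :+ :0 := a) refl (x ^ suc n)

    ^pⁿ-homo-+ : ∀ n x y → (x + y) ^ (p ℕ.^ n) ≈ x ^ (p ℕ.^ n) + y ^ (p ℕ.^ n)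
    ^pⁿ-homo-+ zero    x y = solve 2 (λ x y → (x :+ y) :* :1 := x :* :1 :+ y :* :1) refl x y
    ^pⁿ-homo-+ (suc n) x y = begin
      (x + y) ^ (p ℕ.* p ℕ.^ n)                       ≈⟨ ^-assocʳ (x + y) p (p ℕ.^ n) ⟨
      ((x + y) ^ p) ^ (p ℕ.^ n)                       ≈⟨ ^-congˡ (p ℕ.^ n) (^p-homo-+ x y) ⟩
      (x ^ p + y ^ p) ^ (p ℕ.^ n)                     ≈⟨ ^pⁿ-homo-+ n (x ^ p) (y ^ p) ⟩
      (x ^ p) ^ (p ℕ.^ n) + (y ^ p) ^ (p ℕ.^ n)       ≈⟨ +-cong (^-assocʳ x p (p ℕ.^ n)) (^-assocʳ y p (p ℕ.^ n)) ⟩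
      x ^ (p ℕ.* p ℕ.^ n) + y ^ (p ℕ.* p ℕ.^ n)       ∎

    -- Additivity is applied to x = (x - 1) + 1; this keeps the sign (-1)^(p^n), and with it the
    -- case p = 2, out of the argument.
    ^pⁿ-minus-1 : ∀ n x → (x - 1#) ^ (p ℕ.^ n) ≈ x ^ (p ℕ.^ n) - 1#
    ^pⁿ-minus-1 n x = begin
      (x - 1#) ^ q                      ≈⟨ solve 1 (λ a → a := (a :+ :1) :- :1) refl ((x - 1#) ^ q) ⟩
      ((x - 1#) ^ q + 1#) - 1#          ≈⟨ +-congʳ (+-congˡ (1^ q)) ⟨
      ((x - 1#) ^ q + 1# ^ q) - 1#      ≈⟨ +-congʳ (^pⁿ-homo-+ n (x - 1#) 1#) ⟨
      (x - 1# + 1#) ^ q - 1#            ≈⟨ +-congʳ (^-congˡ q (solve 1 (λ a → a :- :1 :+ :1 := a) refl x)) ⟩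
      x ^ q - 1#                        ∎
      where
      q = p ℕ.^ n
      1^ : ∀ n → 1# ^ n ≈ 1#
      1^ zero    = refl
      1^ (suc n) = trans (*-identityˡ _) (1^ n)

  infix 4 _≈[_]_
  _≈[_]_ : Carrier → Carrier → Carrier → Set
  a ≈[ f ] b = f ∣ a - b

  -- The residue ring keeps carrier and operations and weakens only equality to congruence modulo f,
  -- so elements of `R` serve as residues without conversion.
  _/⟨_⟩ : Carrier → CommutativeRing 0ℓ 0ℓ
  _/⟨_⟩ f = record
    { Carrier = Carrier
    ; _≈_ = _≈[ f ]_
    ; _+_ = _+_
    ; _*_ = _*_
    ; -_ = -_
    ; 0# = 0#
    ; 1# = 1#
    ; isCommutativeRing = record
      { isRing = record
        { +-isAbelianGroup = record
          { isGroup = record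
            { isMonoid = record
              { isSemigroup = record
                { isMagma = record
                  { isEquivalence = record { refl = embed refl ; sym = sym′ ; trans = trans′ }
                  ; ∙-cong = +-cong′
                  }
                ; assoc = λ x y z → embed (+-assoc x y z)
                }
              ; identity = (λ x → embed (+-identityˡ x)) , (λ x → embed (+-identityʳ x))
              }
            ; inverse = (λ x → embed (-‿inverseˡ x)) , (λ x → embed (-‿inverseʳ x))
            ; ⁻¹-cong = neg-cong
            }
          ; comm = λ x y → embed (+-comm x y)
          }
        ; *-cong = *-cong′
        ; *-assoc = λ x y z → embed (*-assoc x y z)
        ; *-identity = (λ x → embed (*-identityˡ x)) , (λ x → embed (*-identityʳ x))
        ; distrib = (λ x y z → embed (distribˡ x y z)) , (λ x y z → embed (distribʳ x y z))
        }
      ; *-comm = λ x y → embed (*-comm x y)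
      }
    }
    where
    embed : ∀ {a b} → a ≈ b → a ≈[ f ] b
    embed = ≈⇒∣-
    sym′ : ∀ {a b} → a ≈[ f ] b → b ≈[ f ] a
    sym′ {a} {b} d = ∣-respʳ (solve 2 (λ a b → :- (a :- b) := b :- a) refl a b) (∣-neg d)
    trans′ : ∀ {a b c} → a ≈[ f ] b → b ≈[ f ] c → a ≈[ f ] c
    trans′ {a} {b} {c} d e = ∣-respʳ (solve 3 (λ a b c → (a :- b) :+ (b :- c) := a :- c) refl a b c) (∣-+ d e)
    +-cong′ : ∀ {a b c d} → a ≈[ f ] b → c ≈[ f ] d → a + c ≈[ f ] b + d
    +-cong′ {a} {b} {c} {d} e e′ =
      ∣-respʳ (solve 4 (λ a b c d → (a :- b) :+ (c :- d) := (a :+ c) :- (b :+ d)) refl a b c d) (∣-+ e e′)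
    *-cong′ : ∀ {a b c d} → a ≈[ f ] b → c ≈[ f ] d → a * c ≈[ f ] b * d
    *-cong′ {a} {b} {c} {d} e e′ =
      ∣-respʳ (solve 4 (λ a b c d → c :* (a :- b) :+ b :* (c :- d) := a :* c :- b :* d) refl a b c d)
        (∣-+ (∣-*ˡ c e) (∣-*ˡ b e′))
    neg-cong : ∀ {a b} → a ≈[ f ] b → - a ≈[ f ] - b
    neg-cong {a} {b} e = ∣-respʳ (solve 2 (λ a b → :- (a :- b) := (:- a) :- (:- b)) refl a b) (∣-neg e)

-- Roots of polynomials over a field

HasInverses : CommutativeRing 0ℓ 0ℓ → Set
HasInverses K = ∀ x → ¬ (x ≈ 0#) → Σ Carrier λ y → x * y ≈ 1#
  where open CommutativeRing K

module Roots (K : CommutativeRing 0ℓ 0ℓ) (inverse : HasInverses K) where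
  open CommutativeRing K
  open DifferenceSolver K
  open RingTheory K
  open import Relation.Binary.Reasoning.Setoid setoid
  open import Algebra.Properties.Group +-group using (x∙y⁻¹≈ε⇒x≈y)

  *-cancel-0 : ∀ {x y} → ¬ (x ≈ 0#) → x * y ≈ 0# → y ≈ 0#
  *-cancel-0 {x} {y} x≉0 xy≈0 with u , xu≈1 ← inverse x x≉0 = begin
    y             ≈⟨ *-identityˡ y ⟨
    1# * y        ≈⟨ *-congʳ xu≈1 ⟨
    (x * u) * y   ≈⟨ solve 3 (λ x u y → (x :* u) :* y := u :* (x :* y)) refl x u y ⟩
    u * (x * y)   ≈⟨ trans (*-congˡ xy≈0) (zeroʳ u) ⟩
    0#            ∎

  ev : ∀ {n} → Vec Carrier n → Carrier → Carrier
  ev []      x = 0#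
  ev (c ∷ v) x = c + x * ev v x

  AllZero : ∀ {n} → Vec Carrier n → Set
  AllZero = All (_≈ 0#)

  ev-zero : ∀ {n} {v : Vec Carrier n} → AllZero v → ∀ x → ev v x ≈ 0#
  ev-zero []       x = refl
  ev-zero (c≈0 ∷ v≈0) x = trans (+-cong c≈0 (trans (*-congˡ (ev-zero v≈0 x)) (zeroʳ x))) (+-identityˡ _)

  -- Synthetic division by X - a: the coefficients of the quotient are the values at a of the
  -- successive tails of v.
  synthetic : ∀ {n} → Carrier → Vec Carrier (suc n) → Vec Carrier n
  synthetic a (c ∷ [])        = []
  synthetic a (c ∷ v@(_ ∷ _)) = ev v a ∷ synthetic a v

  ev-factor : ∀ {n} a (v : Vec Carrier (suc n)) x → ev v x ≈ ev v a + (x - a) * ev (synthetic a v) x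
  ev-factor a (c ∷ []) x =
    solve 3 (λ a c x → c :+ x :* :0 := (c :+ a :* :0) :+ (x :- a) :* :0) refl a c x
  ev-factor a (c ∷ v@(_ ∷ _)) x = begin
    c + x * ev v x
      ≈⟨ +-congˡ (*-congˡ (ev-factor a v x)) ⟩
    c + x * (ev v a + (x - a) * ev (synthetic a v) x)
      ≈⟨ solve 5 (λ a c x e s → c :+ x :* (e :+ (x :- a) :* s)
                   := (c :+ a :* e) :+ (x :- a) :* (e :+ x :* s)) refl a c x (ev v a) (ev (synthetic a v) x) ⟩
    (c + a * ev v a) + (x - a) * (ev v a + x * ev (synthetic a v) x) ∎

  -- Each value of v or of a tail at a is its first coefficient plus a times the value of the next
  -- tail; when all these values vanish, so does each coefficient.
  synthetic-zero : ∀ {n} a (v : Vec Carrier (suc n)) → ev v a ≈ 0# → AllZero (synthetic a v) → AllZero v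
  synthetic-zero a (c ∷ []) e [] = trans (solve 2 (λ a c → c := c :+ a :* :0) refl a c) e ∷ []
  synthetic-zero a (c ∷ v@(_ ∷ _)) e (va≈0 ∷ s≈0) =
    trans (sym (trans (+-congˡ (trans (*-congˡ va≈0) (zeroʳ a))) (+-identityʳ c))) e
      ∷ synthetic-zero a v va≈0 s≈0

  -- Dividing out X - r 0 leaves one coefficient fewer; at the other roots the difference r i - r 0
  -- is invertible, so they are roots of the quotient.
  roots⇒AllZero : ∀ {n} (v : Vec Carrier n) (r : Fin n → Carrier) →
                  (∀ i j → r i ≈ r j → i ≡ j) → (∀ i → ev v (r i) ≈ 0#) → AllZero v
  roots⇒AllZero {zero}  []    r r-inj root = []
  roots⇒AllZero {suc n} v r r-inj root =
    synthetic-zero (r Fin.zero) v (root Fin.zero)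
      (roots⇒AllZero (synthetic (r Fin.zero) v) (r ∘ Fin.suc)
        (λ i j eq → Finₚ.suc-injective (r-inj _ _ eq))
        (λ i → *-cancel-0 (λ eq → 0≢suc (r-inj Fin.zero (Fin.suc i) (sym (x∙y⁻¹≈ε⇒x≈y _ _ eq))))
          (trans (sym (trans (ev-factor (r Fin.zero) v (r (Fin.suc i))) (trans (+-congʳ (root Fin.zero)) (+-identityˡ _)))) (root (Fin.suc i)))))
    where
    0≢suc : ∀ {i : Fin n} → ¬ (Fin.zero ≡ Fin.suc i)
    0≢suc ()

  monomial : ∀ n → Vec Carrier (suc n)
  monomial zero    = 1# ∷ []
  monomial (suc n) = 0# ∷ monomial n

  ev-monomial : ∀ n x → ev (monomial n) x ≈ x ^ n
  ev-monomial zero    x = solve 1 (λ x → :1 :+ x :* :0 := :1) refl x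
  ev-monomial (suc n) x = trans (+-identityˡ _) (*-congˡ (ev-monomial n x))

  ev-∷ʳ0 : ∀ {n} (v : Vec Carrier n) x → ev (v ∷ʳ 0#) x ≈ ev v x
  ev-∷ʳ0 []      x = trans (+-identityˡ _) (zeroʳ x)
  ev-∷ʳ0 (c ∷ v) x = +-congˡ (*-congˡ (ev-∷ʳ0 v x))

  ev-zipWith-+ : ∀ {n} (v w : Vec Carrier n) x → ev (zipWith _+_ v w) x ≈ ev v x + ev w x
  ev-zipWith-+ []      []      x = sym (+-identityˡ _)
  ev-zipWith-+ (c ∷ v) (d ∷ w) x = trans (+-congˡ (*-congˡ (ev-zipWith-+ v w x)))
    (solve 5 (λ c d x e f → (c :+ d) :+ x :* (e :+ f) := (c :+ x :* e) :+ (d :+ x :* f)) refl c d x (ev v x) (ev w x))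

  -- Only the degree matters later. The coefficients arise from (x + 1)(x^n + v(x)) = x^(n+1) + (x^n
  -- + v(x) + x v(x)).
  [x+1]^n-lower : ∀ n → Σ (Vec Carrier n) λ v → ∀ x → (x + 1#) ^ n ≈ x ^ n + ev v x
  [x+1]^n-lower zero    = [] , λ x → sym (+-identityʳ _)
  [x+1]^n-lower (suc n) with v , eq ← [x+1]^n-lower n =
    zipWith _+_ (monomial n) (zipWith _+_ (v ∷ʳ 0#) (0# ∷ v)) , λ x → begin
      (x + 1#) * (x + 1#) ^ n
        ≈⟨ *-congˡ (eq x) ⟩
      (x + 1#) * (x ^ n + ev v x)
        ≈⟨ solve 3 (λ x y e → (x :+ :1) :* (y :+ e) := x :* y :+ (y :+ (e :+ (:0 :+ x :* e)))) refl x (x ^ n) (ev v x) ⟩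
      x * x ^ n + (x ^ n + (ev v x + (0# + x * ev v x)))
        ≈⟨ +-congˡ (+-cong (ev-monomial n x) (+-congʳ (ev-∷ʳ0 v x))) ⟨
      x * x ^ n + (ev (monomial n) x + (ev (v ∷ʳ 0#) x + ev (0# ∷ v) x))
        ≈⟨ +-congˡ (+-congˡ (ev-zipWith-+ (v ∷ʳ 0#) (0# ∷ v) x)) ⟨
      x * x ^ n + (ev (monomial n) x + ev (zipWith _+_ (v ∷ʳ 0#) (0# ∷ v)) x)
        ≈⟨ +-congˡ (ev-zipWith-+ (monomial n) (zipWith _+_ (v ∷ʳ 0#) (0# ∷ v)) x) ⟨
      x * x ^ n + ev (zipWith _+_ (monomial n) (zipWith _+_ (v ∷ʳ 0#) (0# ∷ v))) x ∎

  -- (x + 1)^q - x^q - 1 has degree below q, so q roots make it vanish identically.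
  module _ {q} (r : Fin (suc q) → Carrier) (r-inj : ∀ i j → r i ≈ r j → i ≡ j)
           (additive : ∀ i → (r i + 1#) ^ suc q ≈ r i ^ suc q + 1#)
           (_≈0? : ∀ x → Dec (x ≈ 0#)) where

    [x+1]^q : ∀ x → (x + 1#) ^ suc q ≈ x ^ suc q + 1#
    [x+1]^q x with c ∷ v , eq ← [x+1]^n-lower (suc q) = begin
      (x + 1#) ^ suc q
        ≈⟨ eq x ⟩
      x ^ suc q + (c + x * ev v x)
        ≈⟨ split x ⟩
      (x ^ suc q + 1#) + ev (c - 1# ∷ v) x
        ≈⟨ +-congˡ (ev-zero (roots⇒AllZero (c - 1# ∷ v) r r-inj root) x) ⟩
      (x ^ suc q + 1#) + 0#
        ≈⟨ +-identityʳ _ ⟩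
      x ^ suc q + 1# ∎
      where
      split : ∀ x → x ^ suc q + (c + x * ev v x) ≈ (x ^ suc q + 1#) + ev (c - 1# ∷ v) x
      split x = solve 4 (λ c x y e → y :+ (c :+ x :* e) := (y :+ :1) :+ ((c :- :1) :+ x :* e)) refl c x (x ^ suc q) (ev v x)
      root : ∀ i → ev (c - 1# ∷ v) (r i) ≈ 0#
      root i = begin
        ev (c - 1# ∷ v) (r i)
          ≈⟨ solve 2 (λ a b → b := (a :+ b) :- a) refl (r i ^ suc q + 1#) (ev (c - 1# ∷ v) (r i)) ⟩
        ((r i ^ suc q + 1#) + ev (c - 1# ∷ v) (r i)) - (r i ^ suc q + 1#)
          ≈⟨ +-congʳ (trans (sym (split (r i))) (trans (sym (eq (r i))) (additive i))) ⟩
        (r i ^ suc q + 1#) - (r i ^ suc q + 1#)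
          ≈⟨ -‿inverseʳ _ ⟩
        0# ∎

    -- For invertible y, writing x + y = y (x/y + 1) reduces additivity to the summand 1.
    ^q-homo-+ : ∀ x y → (x + y) ^ suc q ≈ x ^ suc q + y ^ suc q
    ^q-homo-+ x y with y ≈0?
    ... | yes y≈0 = begin
      (x + y) ^ suc q         ≈⟨ ^-congˡ (suc q) (trans (+-congˡ y≈0) (+-identityʳ x)) ⟩
      x ^ suc q               ≈⟨ +-identityʳ _ ⟨
      x ^ suc q + 0#          ≈⟨ +-congˡ (trans (*-congʳ y≈0) (zeroˡ _)) ⟨
      x ^ suc q + y ^ suc q   ∎
    ... | no y≉0 with u , yu≈1 ← inverse y y≉0 = begin
      (x + y) ^ suc q                          ≈⟨ ^-congˡ (suc q) x+y≈ ⟩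
      (y * (x * u + 1#)) ^ suc q               ≈⟨ ^-distrib-* y (x * u + 1#) (suc q) ⟩
      y ^ suc q * (x * u + 1#) ^ suc q         ≈⟨ *-congˡ ([x+1]^q (x * u)) ⟩
      y ^ suc q * ((x * u) ^ suc q + 1#)       ≈⟨ trans (distribˡ _ _ _) (+-congˡ (*-identityʳ _)) ⟩
      y ^ suc q * (x * u) ^ suc q + y ^ suc q  ≈⟨ +-congʳ (^-distrib-* y (x * u) (suc q)) ⟨
      (y * (x * u)) ^ suc q + y ^ suc q        ≈⟨ +-congʳ (^-congˡ (suc q) yxu≈x) ⟩
      x ^ suc q + y ^ suc q                    ∎
      where
      yxu≈x : y * (x * u) ≈ x
      yxu≈x = trans (solve 3 (λ x y u → y :* (x :* u) := x :* (y :* u)) refl x y u)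
                    (trans (*-congˡ yu≈1) (*-identityʳ x))
      x+y≈ : x + y ≈ y * (x * u + 1#)
      x+y≈ = sym (trans (distribˡ _ _ _) (+-cong yxu≈x (*-identityʳ y)))

  ^N-homo-+ : ∀ {N} → Fin N → (r : Fin N → Carrier) → (∀ i j → r i ≈ r j → i ≡ j) →
              (∀ i → (r i + 1#) ^ N ≈ r i ^ N + 1#) → (∀ x → Dec (x ≈ 0#)) →
              ∀ x y → (x + y) ^ N ≈ x ^ N + y ^ N
  ^N-homo-+ {suc q} _ = ^q-homo-+

  fixed-points≤ : ¬ (0# ≈ 1#) → ∀ {Q N} → 2 ℕ.≤ Q → (r : Fin N → Carrier) →
                  (∀ i j → r i ≈ r j → i ≡ j) → (∀ i → r i ^ Q ≈ r i) → N ℕ.≤ Q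
  fixed-points≤ 0≉1 {suc (suc Q)} {N} (ℕ.s≤s (ℕ.s≤s _)) r r-inj fixed with N ℕₚ.≤? suc (suc Q)
  ... | yes N≤Q = N≤Q
  -- The coefficients 0, -1, 0, ..., 0, 1 are those of T^Q - T; since Q ≥ 2 the leading 1 stays
  -- apart from the -1. Q + 1 of the N roots would force that 1 to vanish.
  ... | no  N≰Q = ⊥-elim (0≉1 (sym (monomial-nonzero Q (tail₂
          (roots⇒AllZero (0# ∷ - 1# ∷ monomial Q) (λ i → r (Fin.inject≤ i Q<N))
            (λ i j eq → Finₚ.inject≤-injective Q<N Q<N i j (r-inj _ _ eq))
            (λ i → root (Fin.inject≤ i Q<N)))))))
    where
    Q<N : suc (suc (suc Q)) ℕ.≤ N
    Q<N = ℕₚ.≰⇒> N≰Q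
    tail₂ : ∀ {a b n} {v : Vec Carrier n} → AllZero (a ∷ b ∷ v) → AllZero v
    tail₂ (_ ∷ _ ∷ v≈0) = v≈0
    monomial-nonzero : ∀ n → AllZero (monomial n) → 1# ≈ 0#
    monomial-nonzero zero    (e ∷ _)   = e
    monomial-nonzero (suc n) (_ ∷ v≈0) = monomial-nonzero n v≈0
    root : ∀ i → ev (0# ∷ - 1# ∷ monomial Q) (r i) ≈ 0#
    root i = begin
      0# + x * (- 1# + x * ev (monomial Q) x)  ≈⟨ +-congˡ (*-congˡ (+-congˡ (*-congˡ (ev-monomial Q x)))) ⟩
      0# + x * (- 1# + x * x ^ Q)              ≈⟨ solve 2 (λ x y → :0 :+ x :* (:- :1 :+ x :* y) := x :* (x :* y) :- x) refl x (x ^ Q) ⟩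
      x * (x * x ^ Q) - x                      ≈⟨ +-congʳ (fixed i) ⟩
      x - x                                    ≈⟨ -‿inverseʳ x ⟩
      0#                                       ∎
      where x = r i

-- Characteristic and Fermat's theorem in a finite field

module FiniteFieldTheory (F : FiniteField) where
  open FiniteField F
  open DifferenceSolver cring
  open RingTheory cring
  open Roots cring inverse using (*-cancel-0)
  open import Algebra.Properties.Semiring.Mult semiring renaming (_×_ to _·_) using ()
  open import Relation.Binary.Reasoning.Setoid setoid
  open import Algebra.Properties.Group +-group using (identityʳ-unique; x∙y⁻¹≈ε⇒x≈y)
  import Algebra.Properties.CommutativeMonoid.Sum +-commutativeMonoid as Sum
  import Algebra.Properties.CommutativeMonoid.Sum *-commutativeMonoid as Prod

  index : Carrier → Fin size
  index x = proj₁ (enum-sur x)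

  enum-index : ∀ x → enum (index x) ≈ x
  enum-index x = proj₂ (enum-sur x)

  _≟_ : ∀ x y → Dec (x ≈ y)
  x ≟ y = Dec.map′
    (λ eq → trans (sym (enum-index x)) (trans (reflexive (≡.cong enum eq)) (enum-index y)))
    (λ eq → enum-inj _ _ (trans (enum-index x) (trans eq (sym (enum-index y)))))
    (index x Finₚ.≟ index y)

  bijection⇒permutation : (f g : Carrier → Carrier) → (∀ {x y} → x ≈ y → f x ≈ f y) → (∀ {x y} → x ≈ y → g x ≈ g y) →
    (∀ x → f (g x) ≈ x) → (∀ x → g (f x) ≈ x) → Permutation size size
  bijection⇒permutation f g f-cong g-cong fg gf =
    permutation (λ i → index (f (enum i))) (λ i → index (g (enum i)))
      (λ i → enum-inj _ _ (trans (enum-index _) (trans (f-cong (enum-index _)) (fg _))))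
      (λ i → enum-inj _ _ (trans (enum-index _) (trans (g-cong (enum-index _)) (gf _))))

  -- Translation by 1 permutes F, so the sum S of all elements satisfies S = S + size · 1.
  size·1≈0 : size · 1# ≈ 0#
  size·1≈0 = identityʳ-unique (Sum.sum enum) _ (begin
    Sum.sum enum + size · 1#                                ≈⟨ +-congˡ (Sum.sum-replicate size) ⟨
    Sum.sum enum + Sum.sum {size} (λ _ → 1#)                ≈⟨ Sum.∑-distrib-+ enum (λ _ → 1#) ⟨
    Sum.sum (λ i → enum i + 1#)                             ≈⟨ Sum.sum-cong-≋ (λ i → enum-index (enum i + 1#)) ⟨
    Sum.sum (λ i → enum (index (enum i + 1#)))              ≈⟨ Sum.sum-permute enum π ⟨
    Sum.sum enum                                            ∎)
    where
    π = bijection⇒permutation (_+ 1#) (_- 1#) +-congʳ +-congʳ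
          (solve 1 (λ x → (x :- :1) :+ :1 := x) refl) (solve 1 (λ x → (x :+ :1) :- :1 := x) refl)

  product-nonzero : ∀ {n} (t : Fin n → Carrier) → (∀ i → ¬ (t i ≈ 0#)) → ¬ (Prod.sum t ≈ 0#)
  product-nonzero {zero}  t t≉0 eq = 0≉1 (sym eq)
  product-nonzero {suc n} t t≉0 eq = product-nonzero (t ∘ Fin.suc) (t≉0 ∘ Fin.suc) (*-cancel-0 (t≉0 Fin.zero) eq)

  -- The extra factor a takes the place of the exceptional factor 1.
  product-one-exception : ∀ {n} a (t : Fin n → Carrier) j → t j ≈ 1# → (∀ i → ¬ (i ≡ j) → t i ≈ a) →
                          a * Prod.sum t ≈ a ^ n
  product-one-exception {suc n} a t j tj≈1 ti≈a = *-congˡ (begin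
    Prod.sum t                         ≈⟨ Prod.sum-remove {i = j} t ⟩
    t j * Prod.sum (removeAt t j)      ≈⟨ trans (*-congʳ tj≈1) (*-identityˡ _) ⟩
    Prod.sum (removeAt t j)            ≈⟨ Prod.sum-cong-≋ (λ i → ti≈a _ (Finₚ.punchInᵢ≢i j i)) ⟩
    Prod.sum {n} (λ _ → a)             ≈⟨ Prod.sum-replicate n ⟩
    a ^ n                              ∎)

  ifZero : Carrier → Carrier → Carrier → Carrier
  ifZero b y z with b ≟ 0#
  ... | yes _ = y
  ... | no  _ = z

  ifZero-yes : ∀ {b} y z → b ≈ 0# → ifZero b y z ≈ y
  ifZero-yes {b} y z b≈0 with b ≟ 0#
  ... | yes _ = refl
  ... | no b≉0 = ⊥-elim (b≉0 b≈0)

  ifZero-no : ∀ {b} y z → ¬ (b ≈ 0#) → ifZero b y z ≈ z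
  ifZero-no {b} y z b≉0 with b ≟ 0#
  ... | yes b≈0 = ⊥-elim (b≉0 b≈0)
  ... | no _ = refl

  -- Multiplication by a ≉ 0 permutes F; replacing the factor 0 by 1 keeps the product invertible.
  fermat : ∀ x → x ^ size ≈ x
  fermat a with a ≟ 0#
  -- `index a` witnesses that `size` is positive; the power with exponent 0 would be 1.
  ... | yes a≈0 = helper size (index a)
    where
    helper : ∀ n → Fin n → a ^ n ≈ a
    helper (suc n) _ = trans (*-congʳ a≈0) (trans (zeroˡ _) (sym a≈0))
  ... | no a≉0 with u , au≈1 ← inverse a a≉0 = begin
    a ^ size     ≈⟨ product-one-exception a scale (index 0#) (ifZero-yes 1# a (enum-index 0#)) scale≈a ⟨
    a * Prod.sum scale   ≈⟨ *-congˡ scales≈1 ⟩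
    a * 1#       ≈⟨ *-identityʳ a ⟩
    a            ∎
    where
    unzero : Carrier → Carrier
    unzero b = ifZero b 1# b

    scale : Fin size → Carrier
    scale i = ifZero (enum i) 1# a

    scale≈a : ∀ i → ¬ (i ≡ index 0#) → scale i ≈ a
    scale≈a i i≢ = ifZero-no 1# a (λ eq → i≢ (enum-inj _ _ (trans eq (sym (enum-index 0#)))))

    unzero-step : ∀ i → unzero (enum (index (a * enum i))) ≈ scale i * unzero (enum i)
    unzero-step i with enum i ≟ 0#
    ... | yes b≈0 = trans (ifZero-yes _ _ (trans (enum-index _) (trans (*-congˡ b≈0) (zeroʳ a)))) (sym (*-identityˡ _))
    ... | no b≉0 = trans (ifZero-no _ _ (λ eq → b≉0 (*-cancel-0 a≉0 (trans (sym (enum-index _)) eq)))) (enum-index _)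

    unzero≉0 : ∀ b → ¬ (unzero b ≈ 0#)
    unzero≉0 b eq with b ≟ 0#
    ... | yes _ = 0≉1 (sym eq)
    ... | no b≉0 = b≉0 eq

    π = bijection⇒permutation (a *_) (u *_) *-congˡ *-congˡ
          (λ x → trans (solve 3 (λ a u x → a :* (u :* x) := (a :* u) :* x) refl a u x) (trans (*-congʳ au≈1) (*-identityˡ x)))
          (λ x → trans (solve 3 (λ a u x → u :* (a :* x) := (a :* u) :* x) refl a u x) (trans (*-congʳ au≈1) (*-identityˡ x)))

    P = Prod.sum (unzero ∘ enum)

    P≈scales*P : P ≈ Prod.sum scale * P
    P≈scales*P = begin
      P                                                       ≈⟨ Prod.sum-permute (unzero ∘ enum) π ⟩
      Prod.sum (λ i → unzero (enum (index (a * enum i))))     ≈⟨ Prod.sum-cong-≋ unzero-step ⟩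
      Prod.sum (λ i → scale i * unzero (enum i))              ≈⟨ Prod.∑-distrib-+ scale (unzero ∘ enum) ⟩
      Prod.sum scale * P                                      ∎

    scales≈1 : Prod.sum scale ≈ 1#
    scales≈1 = x∙y⁻¹≈ε⇒x≈y _ _ (*-cancel-0 (product-nonzero (unzero ∘ enum) (unzero≉0 ∘ enum)) (begin
      P * (Prod.sum scale - 1#)      ≈⟨ solve 2 (λ p s → p :* (s :- :1) := s :* p :- p) refl P (Prod.sum scale) ⟩
      Prod.sum scale * P - P         ≈⟨ +-congʳ P≈scales*P ⟨
      P - P                          ≈⟨ -‿inverseʳ P ⟩
      0#                             ∎))

-- Polynomials as operators on sequences

module Polynomials (R : CommutativeRing 0ℓ 0ℓ) where
  open CommutativeRing R
  open DifferenceSolver R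
  open import Algebra.Properties.Semiring.Mult semiring using (×-homo-+) renaming (_×_ to _·_)
  open import Relation.Binary.Reasoning.Setoid setoid

  Seq : Set
  Seq = ℕ → Carrier

  -- A coefficient list acts on sequences with X as the shift; polynomials are
  -- identified when they act equally, so the ring laws are laws of operators.
  act : List Carrier → Seq → Seq
  act []      a n = 0#
  act (c ∷ p) a n = c * a n + act p a (suc n)

  infix 4 _≋_
  -- A record, so that p and q can be recovered by unification, which the bare family of equations
  -- would not allow.
  record _≋_ (p q : List Carrier) : Set where
    constructor acts-equally
    field at : ∀ a n → act p a n ≈ act q a n
  open _≋_ public

  scale : Carrier → List Carrier → List Carrier
  scale c = List.map (c *_)

  act-scale : ∀ c p a n → act (scale c p) a n ≈ c * act p a n
  act-scale c []      a n = sym (zeroʳ c)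
  act-scale c (d ∷ p) a n = trans (+-congˡ (act-scale c p a (suc n)))
    (solve 4 (λ c d x s → (c :* d) :* x :+ c :* s := c :* (d :* x :+ s)) refl c d (a n) _)

  infixl 6 _⊕_
  infixl 7 _⊛_

  -- Abstract, so that unification does not unfold them.
  abstract
    _⊕_ : List Carrier → List Carrier → List Carrier
    []      ⊕ q       = q
    (c ∷ p) ⊕ []      = c ∷ p
    (c ∷ p) ⊕ (d ∷ q) = c + d ∷ p ⊕ q

    neg : List Carrier → List Carrier
    neg = List.map (λ c → - c)

    _⊛_ : List Carrier → List Carrier → List Carrier
    []      ⊛ q = []
    (c ∷ p) ⊛ q = scale c q ⊕ (0# ∷ p ⊛ q)

    act-⊕ : ∀ p q a n → act (p ⊕ q) a n ≈ act p a n + act q a n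
    act-⊕ []      q       a n = sym (+-identityˡ _)
    act-⊕ (c ∷ p) []      a n = sym (+-identityʳ _)
    act-⊕ (c ∷ p) (d ∷ q) a n = trans (+-congˡ (act-⊕ p q a (suc n)))
      (solve 5 (λ c d x s t → (c :+ d) :* x :+ (s :+ t) := (c :* x :+ s) :+ (d :* x :+ t)) refl c d (a n) _ _)

    act-neg : ∀ p a n → act (neg p) a n ≈ - act p a n
    act-neg []      a n = solve 0 (:0 := :- :0) refl
    act-neg (c ∷ p) a n = trans (+-congˡ (act-neg p a (suc n)))
      (solve 3 (λ c x s → (:- c) :* x :+ :- s := :- (c :* x :+ s)) refl c (a n) _)

    act-⊛ : ∀ p q a n → act (p ⊛ q) a n ≈ act p (act q a) n
    act-⊛ []      q a n = refl
    act-⊛ (c ∷ p) q a n = begin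
      act (scale c q ⊕ (0# ∷ p ⊛ q)) a n                     ≈⟨ act-⊕ (scale c q) (0# ∷ p ⊛ q) a n ⟩
      act (scale c q) a n + (0# * a n + act (p ⊛ q) a (suc n)) ≈⟨ +-cong (act-scale c q a n) (trans (+-congʳ (zeroˡ _)) (+-identityˡ _)) ⟩
      c * act q a n + act (p ⊛ q) a (suc n)                  ≈⟨ +-congˡ (act-⊛ p q a (suc n)) ⟩
      c * act q a n + act p (act q a) (suc n)                ∎

  act-cong-< : ∀ p {a b : Seq} n → (∀ i → i ℕ.< length p → a (n ℕ.+ i) ≈ b (n ℕ.+ i)) → act p a n ≈ act p b n
  act-cong-< []      n eq = refl
  act-cong-< (c ∷ p) {a} {b} n eq = +-cong
    (*-congˡ (≡.subst (λ m → a m ≈ b m) (ℕₚ.+-identityʳ n) (eq 0 (ℕ.s≤s ℕ.z≤n))))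
    (act-cong-< p (suc n) (λ i i< → ≡.subst (λ m → a m ≈ b m) (ℕₚ.+-suc n i) (eq (suc i) (ℕ.s≤s i<))))

  act-cong : ∀ p {a b : Seq} → (∀ n → a n ≈ b n) → ∀ n → act p a n ≈ act p b n
  act-cong p eq n = act-cong-< p n (λ i _ → eq (n ℕ.+ i))

  act-zero : ∀ p n → act p (λ _ → 0#) n ≈ 0#
  act-zero []      n = refl
  act-zero (c ∷ p) n = trans (+-cong (zeroʳ c) (act-zero p (suc n))) (+-identityˡ _)

  act-shift : ∀ p (a : Seq) n → act p (a ∘ suc) n ≈ act p a (suc n)
  act-shift []      a n = refl
  act-shift (c ∷ p) a n = +-congˡ (act-shift p a (suc n))

  act-+ : ∀ p (a b : Seq) n → act p (λ m → a m + b m) n ≈ act p a n + act p b n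
  act-+ []      a b n = sym (+-identityˡ _)
  act-+ (c ∷ p) a b n = trans (+-congˡ (act-+ p a b (suc n)))
    (solve 5 (λ c x y s t → c :* (x :+ y) :+ (s :+ t) := (c :* x :+ s) :+ (c :* y :+ t)) refl c (a n) (b n) _ _)

  act-* : ∀ p c (a : Seq) n → act p (λ m → c * a m) n ≈ c * act p a n
  act-* []      c a n = sym (zeroʳ c)
  act-* (d ∷ p) c a n = trans (+-congˡ (act-* p c a (suc n)))
    (solve 4 (λ c d x s → d :* (c :* x) :+ c :* s := c :* (d :* x :+ s)) refl c d (a n) _)

  -- The operator q is linear and commutes with the shift, hence with every combination p of shifts.
  -- This becomes commutativity of the polynomial ring.
  act-comm : ∀ p q a n → act p (act q a) n ≈ act q (act p a) n
  act-comm []      q a n = sym (act-zero q n)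
  act-comm (c ∷ p) q a n = begin
    c * act q a n + act p (act q a) (suc n)          ≈⟨ +-cong (sym (act-* q c a n)) (act-comm p q a (suc n)) ⟩
    act q (λ m → c * a m) n + act q (act p a) (suc n)  ≈⟨ +-congˡ (act-shift q (act p a) n) ⟨
    act q (λ m → c * a m) n + act q (act p a ∘ suc) n  ≈⟨ act-+ q (λ m → c * a m) (act p a ∘ suc) n ⟨
    act q (act (c ∷ p) a) n                            ∎

  ∷-cong : ∀ {c d p q} → c ≈ d → p ≋ q → (c ∷ p) ≋ (d ∷ q)
  ∷-cong c≈d p≋q = acts-equally λ a n → +-cong (*-congʳ c≈d) (at p≋q a (suc n))

  ≋-refl : ∀ {p} → p ≋ p
  ≋-refl = acts-equally λ a n → refl

  ≋-sym : ∀ {p q} → p ≋ q → q ≋ p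
  ≋-sym e = acts-equally λ a n → sym (at e a n)

  ≋-trans : ∀ {p q r} → p ≋ q → q ≋ r → p ≋ r
  ≋-trans e e′ = acts-equally λ a n → trans (at e a n) (at e′ a n)

  private
    ⊕-acts : ∀ {p} q r → (∀ a n → act p a n ≈ act q a n + act r a n) → p ≋ (q ⊕ r)
    ⊕-acts q r e = acts-equally λ a n → trans (e a n) (sym (act-⊕ q r a n))

    ⊕-cong : ∀ {p q r s} → p ≋ q → r ≋ s → p ⊕ r ≋ q ⊕ s
    ⊕-cong {p} {q} {r} {s} e e′ = ⊕-acts q s λ a n → trans (act-⊕ p r a n) (+-cong (at e a n) (at e′ a n))

    ⊕-assoc : ∀ p q r → (p ⊕ q) ⊕ r ≋ p ⊕ (q ⊕ r)
    ⊕-assoc p q r = ⊕-acts p (q ⊕ r) λ a n → trans (act-⊕ (p ⊕ q) r a n) (trans (+-congʳ (act-⊕ p q a n))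
      (trans (+-assoc _ _ _) (+-congˡ (sym (act-⊕ q r a n)))))

    ⊕-comm : ∀ p q → p ⊕ q ≋ q ⊕ p
    ⊕-comm p q = ⊕-acts q p λ a n → trans (act-⊕ p q a n) (+-comm _ _)

    ⊕-identityˡ : ∀ p → [] ⊕ p ≋ p
    ⊕-identityˡ p = acts-equally λ a n → trans (act-⊕ [] p a n) (+-identityˡ _)

    ⊕-identityʳ : ∀ p → p ⊕ [] ≋ p
    ⊕-identityʳ p = acts-equally λ a n → trans (act-⊕ p [] a n) (+-identityʳ _)

    neg-inverseʳ : ∀ p → p ⊕ neg p ≋ []
    neg-inverseʳ p = acts-equally λ a n →
      trans (act-⊕ p _ a n) (trans (+-congˡ (act-neg p a n)) (-‿inverseʳ _))

    neg-cong : ∀ {p q} → p ≋ q → neg p ≋ neg q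
    neg-cong {p} {q} e = acts-equally λ a n →
      trans (act-neg p a n) (trans (-‿cong (at e a n)) (sym (act-neg q a n)))

    ⊛-cong : ∀ {p q r s} → p ≋ q → r ≋ s → p ⊛ r ≋ q ⊛ s
    ⊛-cong {p} {q} {r} {s} e e′ = acts-equally λ a n →
      trans (act-⊛ p r a n) (trans (act-cong p (at e′ a) n) (trans (at e (act s a) n) (sym (act-⊛ q s a n))))

    ⊛-assoc : ∀ p q r → (p ⊛ q) ⊛ r ≋ p ⊛ (q ⊛ r)
    ⊛-assoc p q r = acts-equally λ a n → begin
      act ((p ⊛ q) ⊛ r) a n      ≈⟨ act-⊛ (p ⊛ q) r a n ⟩
      act (p ⊛ q) (act r a) n    ≈⟨ act-⊛ p q (act r a) n ⟩
      act p (act q (act r a)) n  ≈⟨ act-cong p (act-⊛ q r a) n ⟨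
      act p (act (q ⊛ r) a) n    ≈⟨ act-⊛ p (q ⊛ r) a n ⟨
      act (p ⊛ (q ⊛ r)) a n      ∎

    ⊛-comm : ∀ p q → p ⊛ q ≋ q ⊛ p
    ⊛-comm p q = acts-equally λ a n → trans (act-⊛ p q a n) (trans (act-comm p q a n) (sym (act-⊛ q p a n)))

    ⊛-identityˡ : ∀ p → (1# ∷ []) ⊛ p ≋ p
    ⊛-identityˡ p = acts-equally λ a n → trans (act-⊛ (1# ∷ []) p a n)
      (solve 1 (λ x → :1 :* x :+ :0 := x) refl _)

    ⊛-distribʳ : ∀ r p q → (p ⊕ q) ⊛ r ≋ p ⊛ r ⊕ q ⊛ r
    ⊛-distribʳ r p q = ⊕-acts (p ⊛ r) (q ⊛ r) λ a n → begin
      act ((p ⊕ q) ⊛ r) a n                     ≈⟨ act-⊛ (p ⊕ q) r a n ⟩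
      act (p ⊕ q) (act r a) n                   ≈⟨ act-⊕ p q (act r a) n ⟩
      act p (act r a) n + act q (act r a) n     ≈⟨ +-cong (act-⊛ p r a n) (act-⊛ q r a n) ⟨
      act (p ⊛ r) a n + act (q ⊛ r) a n         ∎

  polynomialRing : CommutativeRing 0ℓ 0ℓ
  polynomialRing = record
    { Carrier = List Carrier
    ; _≈_ = _≋_
    ; _+_ = _⊕_
    ; _*_ = _⊛_
    ; -_ = neg
    ; 0# = []
    ; 1# = 1# ∷ []
    ; isCommutativeRing = record
      { isRing = record
        { +-isAbelianGroup = record
          { isGroup = record
            { isMonoid = record
              { isSemigroup = record
                { isMagma = record
                  { isEquivalence = record { refl = ≋-refl ; sym = ≋-sym ; trans = ≋-trans }
                  ; ∙-cong = ⊕-cong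
                  }
                ; assoc = ⊕-assoc
                }
              ; identity = ⊕-identityˡ , ⊕-identityʳ
              }
            ; inverse = (λ p → ≋-trans (⊕-comm _ p) (neg-inverseʳ p)) , neg-inverseʳ
            ; ⁻¹-cong = neg-cong
            }
          ; comm = ⊕-comm
          }
        ; *-cong = ⊛-cong
        ; *-assoc = ⊛-assoc
        ; *-identity = ⊛-identityˡ , (λ p → ≋-trans (⊛-comm p _) (⊛-identityˡ p))
        ; distrib = (λ p q r → ≋-trans (⊛-comm p _) (≋-trans (⊛-distribʳ p q r) (⊕-cong (⊛-comm q p) (⊛-comm r p))))
                  , ⊛-distribʳ
        }
      ; *-comm = ⊛-comm
      }
    }

  private module P = CommutativeRing polynomialRing
  private module PT = RingTheory polynomialRing
  open PT using (_^_; _∣_; _,_)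

  X : List Carrier
  X = 0# ∷ 1# ∷ []

  constant : Carrier → List Carrier
  constant c = c ∷ []

  act-constant : ∀ c a n → act (constant c) a n ≈ c * a n
  act-constant c a n = +-identityʳ _

  act-X : ∀ a n → act X a n ≈ a (suc n)
  act-X a n = solve 2 (λ x y → :0 :* x :+ (:1 :* y :+ :0) := y) refl (a n) (a (suc n))

  act-X^ : ∀ m a n → act (X ^ m) a n ≈ a (n ℕ.+ m)
  act-X^ zero    a n = trans (solve 1 (λ x → :1 :* x :+ :0 := x) refl (a n)) (reflexive (≡.cong a (≡.sym (ℕₚ.+-identityʳ n))))
  act-X^ (suc m) a n = begin
    act (X ⊛ X ^ m) a n      ≈⟨ act-⊛ X (X ^ m) a n ⟩
    act X (act (X ^ m) a) n  ≈⟨ act-X (act (X ^ m) a) n ⟩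
    act (X ^ m) a (suc n)    ≈⟨ act-X^ m a (suc n) ⟩
    a (suc n ℕ.+ m)          ≈⟨ reflexive (≡.cong a (≡.sym (ℕₚ.+-suc n m))) ⟩
    a (n ℕ.+ suc m)          ∎

  act-X^-1 : ∀ m a n → act (X ^ m P.- P.1#) a n ≈ a (n ℕ.+ m) - a n
  act-X^-1 m a n = begin
    act (X ^ m P.- P.1#) a n                 ≈⟨ act-⊕ (X ^ m) (P.- P.1#) a n ⟩
    act (X ^ m) a n + act (P.- P.1#) a n     ≈⟨ +-cong (act-X^ m a n) (trans (act-neg P.1# a n)
                                                  (-‿cong (solve 1 (λ x → :1 :* x :+ :0 := x) refl (a n)))) ⟩
    a (n ℕ.+ m) - a n                        ∎

  ∷≋ : ∀ c p → (c ∷ p) ≋ constant c ⊕ X ⊛ p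
  ∷≋ c p = acts-equally λ a n → sym (begin
    act (constant c ⊕ X ⊛ p) a n              ≈⟨ act-⊕ (constant c) (X ⊛ p) a n ⟩
    act (constant c) a n + act (X ⊛ p) a n    ≈⟨ +-cong (act-constant c a n) (trans (act-⊛ X p a n) (act-X (act p a) n)) ⟩
    c * a n + act p a (suc n)                 ∎)

  constant-cong : ∀ {c d} → c ≈ d → constant c ≋ constant d
  constant-cong c≈d = ∷-cong c≈d ≋-refl

  constant-* : ∀ c d → constant (c * d) ≋ constant c ⊛ constant d
  constant-* c d = acts-equally λ a n → begin
    act (constant (c * d)) a n                ≈⟨ act-constant (c * d) a n ⟩
    c * d * a n                               ≈⟨ solve 3 (λ c d x → c :* d :* x := c :* (d :* x :+ :0) :+ :0) refl c d (a n) ⟩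
    act (constant c) (act (constant d) a) n   ≈⟨ act-⊛ (constant c) (constant d) a n ⟨
    act (constant c ⊛ constant d) a n         ∎

  ∷-⊕-∷ : ∀ c d p q → (c ∷ p) ⊕ (d ∷ q) ≋ (c + d ∷ p ⊕ q)
  ∷-⊕-∷ c d p q = acts-equally λ a n → trans (act-⊕ (c ∷ p) (d ∷ q) a n) (trans
    (solve 5 (λ c d x s t → (c :* x :+ s) :+ (d :* x :+ t) := (c :+ d) :* x :+ (s :+ t)) refl c d (a n) _ _)
    (+-congˡ (sym (act-⊕ p q a (suc n)))))

  ∷-⊛ : ∀ c p q → (c ∷ p) ⊛ q ≋ scale c q ⊕ (0# ∷ p ⊛ q)
  ∷-⊛ c p q = acts-equally λ a n → begin
    act ((c ∷ p) ⊛ q) a n                                    ≈⟨ act-⊛ (c ∷ p) q a n ⟩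
    c * act q a n + act p (act q a) (suc n)                  ≈⟨ +-cong (act-scale c q a n) (act-⊛ p q a (suc n)) ⟨
    act (scale c q) a n + act (p ⊛ q) a (suc n)              ≈⟨ +-congˡ (trans (+-congʳ (zeroˡ _)) (+-identityˡ _)) ⟨
    act (scale c q) a n + act (0# ∷ p ⊛ q) a n               ≈⟨ act-⊕ (scale c q) (0# ∷ p ⊛ q) a n ⟨
    act (scale c q ⊕ (0# ∷ p ⊛ q)) a n                       ∎

  constant-+ : ∀ c d → constant (c + d) ≋ constant c ⊕ constant d
  constant-+ c d = ≋-sym (≋-trans (∷-⊕-∷ c d [] []) (∷-cong refl (P.+-identityˡ [])))

  -- The Euler derivation X · d/dX, the commutator of the action with a(n) ↦ n a(n).
  θ : List Carrier → List Carrier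
  θ []      = []
  θ (c ∷ p) = 0# ∷ (p ⊕ θ p)

  weight : Seq → Seq
  weight a n = (n · 1#) * a n

  act-θ : ∀ p a n → act (θ p) a n ≈ act p (weight a) n - weight (act p a) n
  act-θ []      a n = solve 1 (λ x → :0 := :0 :- x :* :0) refl (n · 1#)
  act-θ (c ∷ p) a n = begin
    0# * a n + act (p ⊕ θ p) a (suc n)
      ≈⟨ +-congˡ (trans (act-⊕ p (θ p) a (suc n)) (+-congˡ (act-θ p a (suc n)))) ⟩
    0# * a n + (act p a (suc n) + (act p (weight a) (suc n) - (1# + n · 1#) * act p a (suc n)))
      ≈⟨ solve 5 (λ c ν x s t → :0 :* x :+ (s :+ (t :- (:1 :+ ν) :* s))
           := (c :* (ν :* x) :+ t) :- ν :* (c :* x :+ s)) refl c (n · 1#) (a n) _ _ ⟩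
    (c * (n · 1# * a n) + act p (weight a) (suc n)) - n · 1# * (c * a n + act p a (suc n)) ∎

  θ-cong : ∀ {p q} → p ≋ q → θ p ≋ θ q
  θ-cong {p} {q} e = acts-equally λ a n → trans (act-θ p a n)
    (trans (+-cong (at e _ n) (-‿cong (*-congˡ (at e a n)))) (sym (act-θ q a n)))

  -- A commutator is a derivation: with w for `weight`, p q w - w p q = (p w - w p) q + p (q w - w
  -- q).
  θ-⊛ : ∀ p q → θ (p ⊛ q) ≋ θ p ⊛ q ⊕ p ⊛ θ q
  θ-⊛ p q = acts-equally λ a n → sym (begin
    act (θ p ⊛ q ⊕ p ⊛ θ q) a n
      ≈⟨ act-⊕ (θ p ⊛ q) (p ⊛ θ q) a n ⟩
    act (θ p ⊛ q) a n + act (p ⊛ θ q) a n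
      ≈⟨ +-cong (trans (act-⊛ (θ p) q a n) (act-θ p (act q a) n))
                (trans (act-⊛ p (θ q) a n) (subtract a n)) ⟩
    (act p (weight (act q a)) n - weight (act p (act q a)) n) + (act p (act q (weight a)) n - act p (weight (act q a)) n)
      ≈⟨ solve 3 (λ s t u → (s :- t) :+ (u :- s) := u :- t) refl _ _ _ ⟩
    act p (act q (weight a)) n - weight (act p (act q a)) n
      ≈⟨ +-cong (act-⊛ p q (weight a) n) (-‿cong (*-congˡ (act-⊛ p q a n))) ⟨
    act (p ⊛ q) (weight a) n - weight (act (p ⊛ q) a) n
      ≈⟨ act-θ (p ⊛ q) a n ⟨
    act (θ (p ⊛ q)) a n ∎)
    where
    subtract : ∀ a n → act p (act (θ q) a) n ≈ act p (act q (weight a)) n - act p (weight (act q a)) n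
    subtract a n = begin
      act p (act (θ q) a) n
        ≈⟨ solve 2 (λ s t → s := (s :+ t) :- t) refl _ (act p (weight (act q a)) n) ⟩
      (act p (act (θ q) a) n + act p (weight (act q a)) n) - act p (weight (act q a)) n
        ≈⟨ +-congʳ (act-+ p (act (θ q) a) (weight (act q a)) n) ⟨
      act p (λ m → act (θ q) a m + weight (act q a) m) n - act p (weight (act q a)) n
        ≈⟨ +-congʳ (act-cong p (λ m → trans (+-congʳ (act-θ q a m))
             (solve 2 (λ s t → (s :- t) :+ t := s) refl _ _)) n) ⟩
      act p (act q (weight a)) n - act p (weight (act q a)) n ∎

  θ-X^-1 : ∀ m → θ (X ^ m P.- P.1#) ≋ constant (m · 1#) ⊛ X ^ m
  θ-X^-1 m = acts-equally λ a n → begin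
    act (θ (X ^ m P.- P.1#)) a n
      ≈⟨ act-θ (X ^ m P.- P.1#) a n ⟩
    act (X ^ m P.- P.1#) (weight a) n - n · 1# * act (X ^ m P.- P.1#) a n
      ≈⟨ +-cong (act-X^-1 m (weight a) n) (-‿cong (*-congˡ (act-X^-1 m a n))) ⟩
    ((n ℕ.+ m) · 1# * a (n ℕ.+ m) - n · 1# * a n) - n · 1# * (a (n ℕ.+ m) - a n)
      ≈⟨ +-congʳ (+-congʳ (*-congʳ (×-homo-+ 1# n m))) ⟩
    ((n · 1# + m · 1#) * a (n ℕ.+ m) - n · 1# * a n) - n · 1# * (a (n ℕ.+ m) - a n)
      ≈⟨ solve 4 (λ ν μ x y → ((ν :+ μ) :* y :- ν :* x) :- ν :* (y :- x) := μ :* y :+ :0) refl (n · 1#) (m · 1#) (a n) (a (n ℕ.+ m)) ⟩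
    m · 1# * a (n ℕ.+ m) + 0#
      ≈⟨ +-congʳ (*-congˡ (act-X^ m a n)) ⟨
    act (constant (m · 1#)) (act (X ^ m) a) n
      ≈⟨ act-⊛ (constant (m · 1#)) (X ^ m) a n ⟨
    act (constant (m · 1#) ⊛ X ^ m) a n ∎

  -- With p′ and q′ the Euler derivatives, p′ q + p q′ = m X^m; together with p q = X^m - 1 this
  -- generates the unit ideal once m is invertible.
  X^-1-coprime-factors : ∀ {p q} m → p ⊛ q ≋ X ^ m P.- P.1# → (∃ λ ν⁻¹ → ν⁻¹ * (m · 1#) ≈ 1#) → PT.Coprime p q
  X^-1-coprime-factors {p} {q} m eq (ν⁻¹ , inv) =
    PT.leibniz⇒coprime {f′ = θ p} {g′ = θ q} {ν⁻¹ = constant ν⁻¹} eq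
      (≋-trans (≋-sym (θ-⊛ p q)) (≋-trans (θ-cong eq) (θ-X^-1 m)))
      (≋-trans (≋-sym (constant-* ν⁻¹ (m · 1#))) (constant-cong inv))

  -- Monic polynomials, the recurrences they define, and division

  monic : ∀ {e} → Vec Carrier e → List Carrier
  monic v = toList (v ∷ʳ 1#)

  length-monic : ∀ {e} (v : Vec Carrier e) → length (monic v) ≡ suc e
  length-monic []      = ≡.refl
  length-monic (c ∷ v) = ≡.cong suc (length-monic v)

  act-∷ʳ : ∀ {m} (v : Vec Carrier m) t a n → act (toList (v ∷ʳ t)) a n ≈ act (toList v) a n + t * a (n ℕ.+ m)
  act-∷ʳ []      t a n = trans (+-comm _ _) (+-congˡ (*-congˡ (reflexive (≡.cong a (≡.sym (ℕₚ.+-identityʳ n))))))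
  act-∷ʳ {suc m} (c ∷ v) t a n = trans (+-congˡ (act-∷ʳ v t a (suc n)))
    (trans (sym (+-assoc _ _ _)) (+-congˡ (*-congˡ (reflexive (≡.cong a (≡.sym (ℕₚ.+-suc n m)))))))

  nth : List Carrier → Seq
  nth []      n       = 0#
  nth (x ∷ l) zero    = x
  nth (x ∷ l) (suc n) = nth l n

  dot : ∀ {e} → Vec Carrier e → Vec Carrier e → Carrier
  dot []      []      = 0#
  dot (c ∷ v) (x ∷ s) = c * x + dot v s

  -- The solution of monic v · a = b with initial values s: extend the window s by
  -- the value that the equation forces and shift.
  module Recurrence {e} (v : Vec Carrier e) where

    extend : Vec Carrier e → Carrier → Vec Carrier (suc e)
    extend s β = s ∷ʳ (β - dot v s)

    run : Vec Carrier e → Seq → Seq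
    run s b zero    = head (extend s (b 0))
    run s b (suc n) = run (tail (extend s (b 0))) (b ∘ suc) n

    nth-∷ʳ : ∀ {m} (s : Vec Carrier m) y n → n ℕ.< m → nth (toList (s ∷ʳ y)) n ≡ nth (toList s) n
    nth-∷ʳ (x ∷ s) y zero    _         = ≡.refl
    nth-∷ʳ (x ∷ s) y (suc n) (ℕ.s≤s n<) = nth-∷ʳ s y n n<

    -- Entries leave the sliding window in order, so the first e + 1 values are s followed by the
    -- first forced value; later forced values enter behind them.
    run-window : ∀ s b n → n ℕ.< suc e → run s b n ≡ nth (toList (extend s (b 0))) n
    run-window s b zero _ = head≡ (extend s (b 0))
      where
      head≡ : ∀ {m} (w : Vec Carrier (suc m)) → head w ≡ nth (toList w) 0
      head≡ (x ∷ w) = ≡.refl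
    run-window s b (suc n) (ℕ.s≤s n<e) =
      ≡.trans (run-window s′ (b ∘ suc) n (ℕₚ.m≤n⇒m≤1+n n<e))
        (≡.trans (nth-∷ʳ s′ _ n n<e) (tail≡ (extend s (b 0)) n))
      where
      s′ = tail (extend s (b 0))
      tail≡ : ∀ {m} (w : Vec Carrier (suc m)) n → nth (toList (tail w)) n ≡ nth (toList w) (suc n)
      tail≡ (x ∷ w) n = ≡.refl

    run-initial : ∀ s b n → n ℕ.< e → run s b n ≡ nth (toList s) n
    run-initial s b n n<e = ≡.trans (run-window s b n (ℕₚ.m≤n⇒m≤1+n n<e)) (nth-∷ʳ s _ n n<e)

    act-monic-window : ∀ {m} (w s : Vec Carrier m) y → act (monic w) (nth (toList (s ∷ʳ y))) 0 ≈ dot w s + y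
    act-monic-window []      []      y = solve 1 (λ y → :1 :* y :+ :0 := :0 :+ y) refl y
    act-monic-window (c ∷ w) (x ∷ s) y = trans (+-congˡ (trans (sym (act-shift (monic w) _ 0)) (act-monic-window w s y)))
      (sym (+-assoc _ _ _))

    run-solves : ∀ s b n → act (monic v) (run s b) n ≈ b n
    run-solves s b zero = begin
      act (monic v) (run s b) 0
        ≈⟨ act-cong-< (monic v) 0 (λ i i< → reflexive (run-window s b i (≡.subst (i ℕ.<_) (length-monic v) i<))) ⟩
      act (monic v) (nth (toList (extend s (b 0)))) 0
        ≈⟨ act-monic-window v s _ ⟩
      dot v s + (b 0 - dot v s)
        ≈⟨ solve 2 (λ d β → d :+ (β :- d) := β) refl (dot v s) (b 0) ⟩
      b 0 ∎
    run-solves s b (suc n) = trans (sym (act-shift (monic v) (run s b) n)) (run-solves _ (b ∘ suc) n)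

  open Recurrence using (run; run-solves; run-initial)

  -- A monic polynomial acts surjectively, because `run` solves monic v · b = a for every a.
  -- Operators that agree on its image agree everywhere.
  monic-cancelʳ : ∀ {e} (v : Vec Carrier e) {p q} → p ⊛ monic v ≋ q ⊛ monic v → p ≋ q
  monic-cancelʳ {e} v {p} {q} eq = acts-equally λ a n → begin
    act p a n                                    ≈⟨ act-cong p (run-solves v s a) n ⟨
    act p (act (monic v) (run v s a)) n          ≈⟨ act-⊛ p (monic v) _ n ⟨
    act (p ⊛ monic v) (run v s a) n              ≈⟨ at eq _ n ⟩
    act (q ⊛ monic v) (run v s a) n              ≈⟨ act-⊛ q (monic v) _ n ⟩
    act q (act (monic v) (run v s a)) n          ≈⟨ act-cong q (run-solves v s a) n ⟩
    act q a n                                    ∎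
    where s = Vec.replicate e 0#

  unit : ∀ n → Vec Carrier (suc n)
  unit zero    = 1# ∷ []
  unit (suc n) = 0# ∷ unit n

  nth-unit-< : ∀ n i → i ℕ.< n → nth (toList (unit n)) i ≡ 0#
  nth-unit-< (suc n) zero    _         = ≡.refl
  nth-unit-< (suc n) (suc i) (ℕ.s≤s i<) = nth-unit-< n i i<

  nth-unit : ∀ n → nth (toList (unit n)) n ≡ 1#
  nth-unit zero    = ≡.refl
  nth-unit (suc n) = nth-unit n

  -- The impulse response: `unit e` is 0, ..., 0, 1, so this is the homogeneous solution that starts
  -- with e zeros and then 1.
  impulse : ∀ {e} → Vec Carrier (suc e) → Seq
  impulse {e} v = run v (unit e) (λ _ → 0#)

  AllZero : ∀ {n} → Vec Carrier n → Set
  AllZero = All (_≈ 0#)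

  AllZero-∷ʳ : ∀ {n} {v : Vec Carrier n} {t} → AllZero v → t ≈ 0# → AllZero (v ∷ʳ t)
  AllZero-∷ʳ []          t≈0 = t≈0 ∷ []
  AllZero-∷ʳ (c≈0 ∷ v≈0) t≈0 = c≈0 ∷ AllZero-∷ʳ v≈0 t≈0

  ∷ʳ-AllZero⇒ : ∀ {n} (v : Vec Carrier n) {t} → AllZero (v ∷ʳ t) → t ≈ 0#
  ∷ʳ-AllZero⇒ []      (t≈0 ∷ []) = t≈0
  ∷ʳ-AllZero⇒ (c ∷ v) (_ ∷ v≈0)  = ∷ʳ-AllZero⇒ v v≈0

  impulse-faithful : ∀ {e} (v : Vec Carrier (suc e)) {m} (r : Vec Carrier m) → m ℕ.≤ suc e →
                     (∀ n → act (toList r) (impulse v) n ≈ 0#) → AllZero r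
  impulse-faithful v {zero}  [] _ _ = []
  impulse-faithful {e} v {suc m} r (ℕ.s≤s m≤e) r·a≈0 with initLast r
  ... | r′ , t , ≡.refl = AllZero-∷ʳ (impulse-faithful v r′ (ℕₚ.m≤n⇒m≤1+n m≤e)
          (λ n → trans (sym (trans (act-∷ʳ r′ t a n) (trans (+-congˡ (trans (*-congʳ t≈0) (zeroˡ _))) (+-identityʳ _)))) (r·a≈0 n))) t≈0
    where
    a = impulse v
    k = e ℕ.∸ m
    k+m≡e : k ℕ.+ m ≡ e
    k+m≡e = ℕₚ.m∸n+n≡m m≤e
    a-initial : ∀ n → n ℕ.< suc e → a n ≡ nth (toList (unit e)) n
    a-initial = run-initial v (unit e) (λ _ → 0#)
    low : act (toList r′) a k ≈ 0#
    low = trans (act-cong-< (toList r′) {a} {λ _ → 0#} k (λ i i< →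
            let k+i<e = ≡.subst (k ℕ.+ i ℕ.<_) k+m≡e (ℕₚ.+-monoʳ-< k (≡.subst (i ℕ.<_) (length-toList r′) i<))
            in reflexive (≡.trans (a-initial (k ℕ.+ i) (ℕₚ.m≤n⇒m≤1+n k+i<e)) (nth-unit-< e (k ℕ.+ i) k+i<e))))
          (act-zero (toList r′) k)
    t≈0 : t ≈ 0#
    t≈0 = begin
      t                                         ≈⟨ solve 1 (λ t → t := :0 :+ t :* :1) refl t ⟩
      0# + t * 1#                               ≈⟨ +-cong low (*-congˡ (reflexive (≡.trans (≡.cong a k+m≡e)
                                                     (≡.trans (a-initial e ℕₚ.≤-refl) (nth-unit e))))) ⟨
      act (toList r′) a k + t * a (k ℕ.+ m)     ≈⟨ act-∷ʳ r′ t a k ⟨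
      act (toList (r′ ∷ʳ t)) a k                ≈⟨ r·a≈0 k ⟩
      0#                                        ∎

  -- A multiple of monic v annihilates the impulse response, which detects every polynomial with at
  -- most e coefficients.
  monic∣small⇒zero : ∀ {e} (v : Vec Carrier e) {m} (r : Vec Carrier m) → m ℕ.≤ e → monic v ∣ toList r → AllZero r
  monic∣small⇒zero [] [] ℕ.z≤n _ = []
  monic∣small⇒zero v@(_ ∷ _) r m≤e (Q , eq) = impulse-faithful v r m≤e λ n → begin
    act (toList r) (impulse v) n                ≈⟨ at eq (impulse v) n ⟨
    act (Q ⊛ monic v) (impulse v) n             ≈⟨ act-⊛ Q (monic v) (impulse v) n ⟩
    act Q (act (monic v) (impulse v)) n         ≈⟨ act-cong Q (run-solves v _ _) n ⟩
    act Q (λ _ → 0#) n                          ≈⟨ act-zero Q n ⟩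
    0#                                          ∎

  AllZero⇒≋ : ∀ {m} {r : Vec Carrier m} → AllZero r → toList r ≋ []
  AllZero⇒≋ []          = ≋-refl
  AllZero⇒≋ (c≈0 ∷ r≈0) = acts-equally λ a n →
    trans (+-cong (trans (*-congʳ c≈0) (zeroˡ _)) (at (AllZero⇒≋ r≈0) a (suc n))) (+-identityˡ _)

  -- If e′ < e, then monic w has at most e coefficients and would be zero, against its leading 1.
  monic-degree-≤ : ¬ (0# ≈ 1#) → ∀ {e e′} (v : Vec Carrier e) (w : Vec Carrier e′) → monic v ∣ monic w → e ℕ.≤ e′
  monic-degree-≤ 0≉1 {e} {e′} v w d with e ℕₚ.≤? e′
  ... | yes e≤e′ = e≤e′
  ... | no e≰e′ = ⊥-elim (0≉1 (sym (∷ʳ-AllZero⇒ w (monic∣small⇒zero v (w ∷ʳ 1#) (ℕₚ.≰⇒> e≰e′) d))))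

  monic-+-low : ∀ {N} (u : Vec Carrier N) l → length l ℕ.≤ N → ∃ λ (w : Vec Carrier N) → l ⊕ monic u ≋ monic w
  monic-+-low u       []      _           = u , P.+-identityˡ _
  monic-+-low (c ∷ u) (d ∷ l) (ℕ.s≤s l≤N) with w , eq ← monic-+-low u l l≤N = d + c ∷ w , ≋-trans (∷-⊕-∷ d c l (monic u)) (∷-cong refl eq)

  monic-⊛ : ∀ {m n} (v : Vec Carrier m) (w : Vec Carrier n) → ∃ λ (u : Vec Carrier (m ℕ.+ n)) → monic v ⊛ monic w ≋ monic u
  monic-⊛ []      w = w , P.*-identityˡ _
  monic-⊛ {suc m} {n} (c ∷ v) w with u , eq ← monic-⊛ v w
    with u′ , eq′ ← monic-+-low (0# ∷ u) (scale c (monic w))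
           (≡.subst (ℕ._≤ suc (m ℕ.+ n)) (≡.sym (≡.trans (Listₚ.length-map (c *_) (monic w)) (length-monic w))) (ℕ.s≤s (ℕₚ.m≤n+m n m)))
    = u′ , ≋-trans (∷-⊛ c (monic v) (monic w)) (≋-trans (P.+-congˡ (∷-cong refl eq)) eq′)

  monic-^ : ∀ {m} (v : Vec Carrier m) s → ∃ λ (u : Vec Carrier (s ℕ.* m)) → monic v ^ s ≋ monic u
  monic-^ v zero    = [] , ≋-refl
  monic-^ v (suc s) with u , eq ← monic-^ v s with u′ , eq′ ← monic-⊛ v u = u′ , ≋-trans (P.*-cong (≋-refl {monic v}) eq) eq′

  divMod : ∀ {e} (v : Vec Carrier e) p → ∃₂ λ Q (r : Vec Carrier e) → p ≋ Q ⊛ monic v ⊕ toList r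
  divMod {e} v [] = [] , Vec.replicate e 0# ,
    ≋-sym (≋-trans (P.+-cong (P.zeroˡ _) (AllZero⇒≋ (zeros e))) (P.+-identityˡ []))
    where
    zeros : ∀ n → AllZero (Vec.replicate n 0#)
    zeros zero    = []
    zeros (suc n) = refl ∷ zeros n
  -- Horner division: with p = Q v + r, the list c + X r has one coefficient too many. Its top
  -- coefficient t becomes the next coefficient of the quotient, and t times monic v is subtracted.
  divMod v (c ∷ p) with Q , r , eq ← divMod v p with r′ , t , cr≡ ← initLast (c ∷ r) =
    t ∷ Q , Vec.zipWith (λ x y → x - t * y) r′ v , acts-equally λ a n → begin
      c * a n + act p a (suc n)
        ≈⟨ +-congˡ (trans (at eq a (suc n)) (act-⊕ (Q ⊛ monic v) (toList r) a (suc n))) ⟩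
      c * a n + (act (Q ⊛ monic v) a (suc n) + act (toList r) a (suc n))
        ≈⟨ solve 3 (λ s t u → s :+ (t :+ u) := t :+ (s :+ u)) refl _ _ _ ⟩
      act (Q ⊛ monic v) a (suc n) + act (toList (c ∷ r)) a n
        ≈⟨ +-cong (act-⊛ Q (monic v) a (suc n)) (reflexive (≡.cong (λ w → act (toList w) a n) cr≡)) ⟩
      act Q (act (monic v) a) (suc n) + act (toList (r′ ∷ʳ t)) a n
        ≈⟨ +-congˡ (reduced v r′ t a n) ⟩
      act Q (act (monic v) a) (suc n) + (t * act (monic v) a n + act (toList (Vec.zipWith (λ x y → x - t * y) r′ v)) a n)
        ≈⟨ solve 3 (λ s t u → s :+ (t :+ u) := (t :+ s) :+ u) refl _ _ _ ⟩
      act (t ∷ Q) (act (monic v) a) n + act (toList (Vec.zipWith (λ x y → x - t * y) r′ v)) a n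
        ≈⟨ trans (act-⊕ ((t ∷ Q) ⊛ monic v) (toList (Vec.zipWith (λ x y → x - t * y) r′ v)) a n) (+-congʳ (act-⊛ (t ∷ Q) (monic v) a n)) ⟨
      act ((t ∷ Q) ⊛ monic v ⊕ toList (Vec.zipWith (λ x y → x - t * y) r′ v)) a n ∎
    where
    reduced : ∀ {m} (v r : Vec Carrier m) t a n → act (toList (r ∷ʳ t)) a n
              ≈ t * act (monic v) a n + act (toList (Vec.zipWith (λ x y → x - t * y) r v)) a n
    reduced []      []      t a n = solve 2 (λ t x → t :* x :+ :0 := t :* (:1 :* x :+ :0) :+ :0) refl t (a n)
    reduced (c ∷ v) (d ∷ r) t a n = trans (+-congˡ (reduced v r t a (suc n)))
      (solve 6 (λ c d t x s u → d :* x :+ (t :* s :+ u) := t :* (c :* x :+ s) :+ ((d :- t :* c) :* x :+ u))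
         refl c d t (a n) (act (monic v) a (suc n)) _)

  -- The remainder modulo monic v annihilates the impulse response as well and is too short to do so
  -- unless it is zero. This turns a period m into divisibility of X^m - 1.
  impulse-annihilator : ∀ {e} (v : Vec Carrier (suc e)) p → (∀ n → act p (impulse v) n ≈ 0#) → monic v ∣ p
  impulse-annihilator {e} v p p·a≈0 with Q , r , eq ← divMod v p =
    Q , ≋-sym (≋-trans eq (≋-trans (P.+-congˡ {Q ⊛ monic v} (AllZero⇒≋ (impulse-faithful v r ℕₚ.≤-refl r·a≈0))) (P.+-identityʳ _)))
    where
    a = impulse v
    r·a≈0 : ∀ n → act (toList r) a n ≈ 0#
    r·a≈0 n = begin
      act (toList r) a n
        ≈⟨ +-identityˡ _ ⟨
      0# + act (toList r) a n
        ≈⟨ +-congʳ (trans (act-⊛ Q (monic v) a n) (trans (act-cong Q (run-solves v _ _) n) (act-zero Q n))) ⟨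
      act (Q ⊛ monic v) a n + act (toList r) a n
        ≈⟨ act-⊕ (Q ⊛ monic v) (toList r) a n ⟨
      act (Q ⊛ monic v ⊕ toList r) a n
        ≈⟨ at eq a n ⟨
      act p a n
        ≈⟨ p·a≈0 n ⟩
      0# ∎

-- Primes and prime powers

prime-divisor : ∀ k → 2 ℕ.≤ k → ∃₂ λ ℓ k′ → Prime ℓ × k ≡ k′ ℕ.* ℓ
prime-divisor k@(suc _) 2≤k with factorise k
... | record { factors = [] ; isFactorisation = k≡1 } = ⊥-elim (ℕₚ.<⇒≢ 2≤k (≡.sym k≡1))
... | record { factors = ℓ ∷ ℓs ; isFactorisation = k≡ ; factorsPrime = pr ListAll.∷ _ } =
  ℓ , product ℓs , pr , ≡.trans k≡ (ℕₚ.*-comm ℓ (product ℓs))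

valuation : ∀ {ℓ} → Prime ℓ → ∀ n → 0 ℕ.< n → ∃₂ λ a u → n ≡ ℓ ℕ.^ a ℕ.* u × ¬ ℓ ℕ∣ u
valuation {ℓ} pr = <-rec _ λ n rec 0<n → step n (λ {m} → rec {m}) 0<n
  where
  step : ∀ n → (∀ {m} → m ℕ.< n → 0 ℕ.< m → ∃₂ λ a u → m ≡ ℓ ℕ.^ a ℕ.* u × ¬ ℓ ℕ∣ u) →
         0 ℕ.< n → ∃₂ λ a u → n ≡ ℓ ℕ.^ a ℕ.* u × ¬ ℓ ℕ∣ u
  step n rec 0<n with ℓ ℕ∣.∣? n
  ... | no ℓ∤n = 0 , n , ≡.sym (ℕₚ.+-identityʳ n) , ℓ∤n
  ... | yes (ℕ∣.divides m ≡.refl) = let a , u , m≡ , ℓ∤u = rec m<mℓ 0<m in suc a , u , eq a u m≡ , ℓ∤u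
    where
    0<m : 0 ℕ.< m
    0<m = ℕₚ.n≢0⇒n>0 λ { ≡.refl → ℕₚ.n≮0 0<n }
    m<mℓ : m ℕ.< m ℕ.* ℓ
    m<mℓ = ℕₚ.m<m*n m ℓ {{ℕ.>-nonZero 0<m}} (ℕ.nonTrivial⇒n>1 ℓ {{prime⇒nonTrivial pr}})
    eq : ∀ a u → m ≡ ℓ ℕ.^ a ℕ.* u → m ℕ.* ℓ ≡ ℓ ℕ.* ℓ ℕ.^ a ℕ.* u
    eq a u m≡ = ≡.trans (ℕₚ.*-comm m ℓ) (≡.trans (≡.cong (ℓ ℕ.*_) m≡) (≡.sym (ℕₚ.*-assoc ℓ (ℓ ℕ.^ a) u)))

^∣*-cancelʳ : ∀ {ℓ c} → Prime ℓ → ¬ ℓ ℕ∣ c → ∀ a m → ℓ ℕ.^ a ℕ∣ m ℕ.* c → ℓ ℕ.^ a ℕ∣ m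
^∣*-cancelʳ pr ℓ∤c zero    m _ = ℕ∣.1∣ m
^∣*-cancelʳ {ℓ} {c} pr ℓ∤c (suc a) m d with euclidsLemma m c pr (ℕ∣.∣-trans (ℕ∣.m∣m*n (ℓ ℕ.^ a)) d)
... | inj₂ ℓ∣c = ⊥-elim (ℓ∤c ℓ∣c)
... | inj₁ (ℕ∣.divides k ≡.refl) = ≡.subst (ℓ ℕ.* ℓ ℕ.^ a ℕ∣_) (ℕₚ.*-comm ℓ k)
  (ℕ∣.*-monoʳ-∣ ℓ (^∣*-cancelʳ pr ℓ∤c a k (ℕ∣.*-cancelˡ-∣ ℓ {{prime⇒nonZero pr}} (≡.subst (ℓ ℕ.* ℓ ℕ.^ a ℕ∣_) eq d))))
  where
  eq : k ℕ.* ℓ ℕ.* c ≡ ℓ ℕ.* (k ℕ.* c)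
  eq = ≡.trans (≡.cong (ℕ._* c) (ℕₚ.*-comm k ℓ)) (ℕₚ.*-assoc ℓ k c)

∣m+n∣n⇒∣m : ∀ {k} m n → k ℕ∣ m ℕ.+ n → k ℕ∣ n → k ℕ∣ m
∣m+n∣n⇒∣m {k} m n k∣m+n = ℕ∣.∣m+n∣m⇒∣n (≡.subst (k ℕ∣_) (ℕₚ.+-comm m n) k∣m+n)

prime∣prime⇒≡ : ∀ {ℓ ℓ′} → Prime ℓ → Prime ℓ′ → ℓ ℕ∣ ℓ′ → ℓ ≡ ℓ′
prime∣prime⇒≡ {ℓ} pr pr′ ℓ∣ℓ′ with prime⇒irreducible pr′ ℓ∣ℓ′
... | inj₁ ≡.refl = ⊥-elim (ℕₚ.<-irrefl ≡.refl (ℕ.nonTrivial⇒n>1 ℓ {{prime⇒nonTrivial pr}}))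
... | inj₂ eq     = eq

-- Both rings share their multiplication, but the two powers take it from different bundles and
-- agree only by induction on n.
^-quotient : ∀ (R : CommutativeRing 0ℓ 0ℓ) f x n →
             RingTheory._^_ (RingTheory._/⟨_⟩ R f) x n ≡ RingTheory._^_ R x n
^-quotient R f x zero    = ≡.refl
^-quotient R f x (suc n) = ≡.cong (CommutativeRing._*_ R x) (^-quotient R f x n)

-- The exact order of an element

module Order (R : CommutativeRing 0ℓ 0ℓ) where
  open CommutativeRing R
  open RingTheory R
  open import Relation.Binary.Reasoning.Setoid setoid

  ^-multiple≈1 : ∀ {x} n k → x ^ n ≈ 1# → x ^ (k ℕ.* n) ≈ 1#
  ^-multiple≈1 n zero    eq = refl
  ^-multiple≈1 {x} n (suc k) eq = trans (^-homo-* x n (k ℕ.* n))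
    (trans (*-cong eq (^-multiple≈1 n k eq)) (*-identityˡ 1#))

  -- Bézout's identity over the naturals has the form g + b = c; x^b is replaced by 1 instead of
  -- being inverted.
  ^-difference≈1 : ∀ {x} g b {c} → g ℕ.+ b ≡ c → x ^ b ≈ 1# → x ^ c ≈ 1# → x ^ g ≈ 1#
  ^-difference≈1 {x} g b ≡.refl xᵇ≈1 xᶜ≈1 = begin
    x ^ g            ≈⟨ *-identityʳ _ ⟨
    x ^ g * 1#       ≈⟨ *-congˡ xᵇ≈1 ⟨
    x ^ g * x ^ b    ≈⟨ ^-homo-* x g b ⟨
    x ^ (g ℕ.+ b)    ≈⟨ xᶜ≈1 ⟩
    1#               ∎

  ^-gcd≈1 : ∀ {x} m n → x ^ m ≈ 1# → x ^ n ≈ 1# → x ^ gcd m n ≈ 1#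
  ^-gcd≈1 m n xᵐ≈1 xⁿ≈1 with Bézout.identity (gcd-GCD m n)
  ... | Bézout.+- s t eq = ^-difference≈1 _ (t ℕ.* n) eq (^-multiple≈1 n t xⁿ≈1) (^-multiple≈1 m s xᵐ≈1)
  ... | Bézout.-+ s t eq = ^-difference≈1 _ (s ℕ.* m) eq (^-multiple≈1 m s xᵐ≈1) (^-multiple≈1 n t xⁿ≈1)

  -- For g = gcd(m, d), Bézout gives x^g = 1. If d/g were not 1, a prime ℓ dividing it would give
  -- x^(d/ℓ) = 1, which is excluded.
  order-∣ : ∀ {x d} → 0 ℕ.< d → x ^ d ≈ 1# → (∀ ℓ k → Prime ℓ → d ≡ k ℕ.* ℓ → ¬ (x ^ k ≈ 1#)) →
            ∀ m → x ^ m ≈ 1# → d ℕ∣ m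
  order-∣ {x} {d} 0<d xᵈ≈1 maximal m xᵐ≈1 with gcd[m,n]∣n m d
  ... | ℕ∣.divides zero          d≡ = ⊥-elim (ℕₚ.<⇒≢ 0<d (≡.sym d≡))
  ... | ℕ∣.divides 1             d≡ =
    ≡.subst (_ℕ∣ m) (≡.sym (≡.trans d≡ (ℕₚ.*-identityˡ (gcd m d)))) (gcd[m,n]∣m m d)
  ... | ℕ∣.divides k@(suc (suc _)) d≡ with ℓ , k′ , pr , k≡ ← prime-divisor k (ℕ.s≤s (ℕ.s≤s ℕ.z≤n)) =
    ⊥-elim (maximal ℓ (k′ ℕ.* gcd m d) pr d≡′ (^-multiple≈1 (gcd m d) k′ (^-gcd≈1 m d xᵐ≈1 xᵈ≈1)))
    where
    d≡′ : d ≡ k′ ℕ.* gcd m d ℕ.* ℓ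
    d≡′ = ≡.trans d≡ (≡.trans (≡.cong (ℕ._* gcd m d) k≡) (≡.trans (ℕₚ.*-assoc k′ ℓ (gcd m d))
            (≡.trans (≡.cong (k′ ℕ.*_) (ℕₚ.*-comm ℓ (gcd m d))) (≡.sym (ℕₚ.*-assoc k′ (gcd m d) ℓ)))))

-- Monic divisors, irreducible factors and residue fields over F

module FieldPolynomials (F : FiniteField) where
  open FiniteField F
  open FiniteFieldTheory F
  open Polynomials cring public
  module P = CommutativeRing polynomialRing
  module PT = RingTheory polynomialRing
  open PT using (_∣_; _^_; _,_; ∣-respʳ; ∣-*ˡ; ∣-*ʳ; ∣-trans; ∣-refl; Coprime; coprime-product∣; coprime-*ʳ) public
  private module FR = DifferenceSolver cring

  constant-inverse : ∀ {t u} → t * u ≈ 1# → constant u ⊛ constant t ≋ P.1#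
  constant-inverse {t} {u} tu≈1 = ≋-trans (≋-sym (constant-* u t)) (constant-cong (trans (*-comm u t) tu≈1))

  -- Over a field the degree hidden by trailing zeros can be found: p is zero or a unit t, with
  -- inverse u, times a monic polynomial. The bound on n lets recursion on remainders terminate.
  data Normal (p : List Carrier) : Set where
    vanishes : p ≋ [] → Normal p
    scaled   : ∀ {n} t u (v : Vec Carrier n) → constant u ⊛ constant t ≋ P.1# → n ℕ.< length p →
               p ≋ constant t ⊛ monic v → Normal p

  normalise : ∀ p → Normal p
  normalise [] = vanishes ≋-refl
  normalise (c ∷ p) with normalise p
  ... | scaled t u v ut≈1 n< eq = scaled t u (u * c ∷ v) ut≈1 (ℕ.s≤s n<)
    (≋-trans (∷≋ c p) (≋-trans (P.+-congˡ {constant c} (P.*-congˡ {X} eq))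
      (≋-trans (PT.factor-unit (constant c) X (monic v) ut≈1)
        (P.*-congˡ {constant t} (≋-trans (P.+-congʳ {X ⊛ monic v} (≋-sym (constant-* u c))) (≋-sym (∷≋ (u * c) (monic v))))))))
  ... | vanishes p≋[] with c ≟ 0#
  ...   | yes c≈0 = vanishes (≋-trans (∷-cong c≈0 p≋[]) (acts-equally λ a n → FR.solve 1 (λ x → FR.:0 FR.:* x FR.:+ FR.:0 FR.:= FR.:0) refl (a n)))
  ...   | no c≉0 with u , cu≈1 ← inverse c c≉0 =
    scaled c u [] (constant-inverse cu≈1) (ℕ.s≤s ℕ.z≤n) (≋-trans (∷-cong refl p≋[]) (≋-sym (P.*-identityʳ (constant c))))

  _∣?_ : ∀ {e} (v : Vec Carrier e) p → Dec (monic v ∣ p)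
  _∣?_ v p with Q , r , eq ← divMod v p = Dec.map′
    (λ r≈0 → PT.quotient-remainder⇒∣ {q = Q} eq (AllZero⇒≋ r≈0))
    (λ d → monic∣small⇒zero v r ℕₚ.≤-refl (PT.∣-remainder {q = Q} eq d))
    (all? (_≟ 0#) r)

  monic-cong : ∀ {e} {v w : Vec Carrier e} → Pointwise _≈_ v w → monic v ≋ monic w
  monic-cong []         = ≋-refl
  monic-cong (c≈d ∷ eq) = ∷-cong c≈d (monic-cong eq)

  -- The enumeration of F reaches each element only up to ≈, so an exhaustive search is complete
  -- only for properties that respect it.
  anyVec? : ∀ {m} {Q : Vec Carrier m → Set} → (∀ {v w} → Pointwise _≈_ v w → Q v → Q w) →
            (∀ v → Dec (Q v)) → Dec (∃ Q)
  anyVec? {zero}  resp Q? = Dec.map′ (λ q → [] , q) (λ { ([] , q) → q }) (Q? [])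
  anyVec? {suc m} resp Q? = Dec.map′
    (λ { (i , v , q) → enum i ∷ v , q })
    (λ { (c ∷ v , q) → index c , v , resp (sym (enum-index c) ∷ Pointwise.refl refl) q })
    (Finₚ.any? λ i → anyVec? (λ eq → resp (refl ∷ eq)) (λ v → Q? (enum i ∷ v)))

  Irreducible : ∀ {e} → Vec Carrier e → Set
  Irreducible {e} v = ∀ {m} (w : Vec Carrier m) → 0 ℕ.< m → m ℕ.< e → ¬ (monic w ∣ monic v)

  ProperDivisor : ∀ {e} → Vec Carrier e → Set
  ProperDivisor {e} v = ∃₂ λ m (w : Vec Carrier m) → 0 ℕ.< m × m ℕ.< e × monic w ∣ monic v

  properDivisor? : ∀ {e} (v : Vec Carrier e) → Dec (ProperDivisor v)
  properDivisor? {e} v = Dec.map′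
    (λ { (i , 0<i , w , d) → Fin.toℕ i , w , 0<i , Finₚ.toℕ<n i , d })
    to
    (Finₚ.any? λ i → (0 ℕₚ.<? Fin.toℕ i) ×-dec anyVec? {Fin.toℕ i} {λ w → monic w ∣ monic v} resp (λ w → w ∣? monic v))
    where
    resp : ∀ {m} {w w′ : Vec Carrier m} → Pointwise _≈_ w w′ → monic w ∣ monic v → monic w′ ∣ monic v
    resp {w = w} {w′} eq (h , eq′) = h , ≋-trans (P.*-congˡ {h} (≋-sym (monic-cong eq))) eq′
    to : ProperDivisor v → ∃ λ (i : Fin e) → 0 ℕ.< Fin.toℕ i × (∃ λ (w : Vec Carrier (Fin.toℕ i)) → monic w ∣ monic v)
    to (m , w , 0<m , m<e , d) = Fin.fromℕ< m<e ,
      ≡.subst (λ n → 0 ℕ.< n × (∃ λ (w : Vec Carrier n) → monic w ∣ monic v)) (≡.sym (Finₚ.toℕ-fromℕ< m<e)) (0<m , w , d)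

  monic≉0 : ∀ {e} (v : Vec Carrier e) → ¬ (monic v ≋ [])
  monic≉0 v eq = ℕₚ.<-irrefl ≡.refl (monic-degree-≤ 0≉1 (0# ∷ v) v ([] , ≋-trans (P.zeroˡ _) (≋-sym eq)))

  -- The quotient is a unit times a monic w′, and divisibility in both directions expresses equality
  -- up to that unit. Comparing degrees with 0 < m gives n < e.
  cofactor : ∀ {e m} (v : Vec Carrier e) (w : Vec Carrier m) → 0 ℕ.< m → monic w ∣ monic v →
             ∃₂ λ n (w′ : Vec Carrier n) → n ℕ.< e × monic w ⊛ monic w′ ∣ monic v × monic v ∣ monic w ⊛ monic w′
  cofactor {e} v w 0<m (h , hw≋v) = from-normal (normalise h)
    where
    from-normal : Normal h → ∃₂ λ n (w′ : Vec Carrier n) → n ℕ.< e × monic w ⊛ monic w′ ∣ monic v × monic v ∣ monic w ⊛ monic w′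
    from-normal (vanishes h≋[]) = ⊥-elim (monic≉0 v (≋-trans (≋-sym hw≋v) (≋-trans (P.*-congʳ h≋[]) (P.zeroˡ _))))
    from-normal (scaled {n} t u w′ ut≈1 _ h≋) = n , w′ , n<e , (constant t , v≋tww′) , PT.unit-multiple-∣ ut≈1 v≋tww′
      where
      v≋tww′ : constant t ⊛ (monic w ⊛ monic w′) ≋ monic v
      v≋tww′ = PT.refactor h≋ hw≋v
      x = monic-⊛ w w′
      n<e : n ℕ.< e
      n<e = ℕₚ.<-≤-trans (ℕₚ.m<n+m n 0<m)
        (monic-degree-≤ 0≉1 (proj₁ x) v (constant t , ≋-trans (P.*-congˡ (≋-sym (proj₂ x))) v≋tww′))

  module _ (A Ψ : List Carrier) (coprime-factors : ∀ {p q} → p ⊛ q ∣ A → Coprime p q) where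

    -- Factors of A are coprime, so if both factors of a reducible divisor of A divided Ψ, it would divide Ψ too.
    irreducible-factor-avoiding : ∀ e (v : Vec Carrier e) → monic v ∣ A → ¬ (monic v ∣ Ψ) →
      ∃₂ λ e′ (v′ : Vec Carrier e′) → monic v′ ∣ A × (¬ (monic v′ ∣ Ψ)) × Irreducible v′
    irreducible-factor-avoiding e = <-rec Avoiding step e
      where
      Result : Set
      Result = ∃₂ λ e′ (v′ : Vec Carrier e′) → monic v′ ∣ A × (¬ (monic v′ ∣ Ψ)) × Irreducible v′
      Avoiding : ℕ → Set
      Avoiding e = (v : Vec Carrier e) → monic v ∣ A → ¬ (monic v ∣ Ψ) → Result
      step : ∀ e → (∀ {m} → m ℕ.< e → Avoiding m) → Avoiding e
      step e rec v v∣A v∤Ψ = reduce (properDivisor? v)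
        where
        reduceBy : ∀ {m} (w : Vec Carrier m) → 0 ℕ.< m → m ℕ.< e → monic w ∣ monic v → Dec (monic w ∣ Ψ) → Result
        reduceBy w 0<m m<e w∣v (no w∤Ψ)  = rec m<e w (∣-trans w∣v v∣A) w∤Ψ
        reduceBy w 0<m m<e w∣v (yes w∣Ψ) = let n , w′ , n<e , ww′∣v , v∣ww′ = cofactor v w 0<m w∣v in
          rec n<e w′ (∣-trans (∣-*ˡ (monic w) ∣-refl) (∣-trans ww′∣v v∣A)) (λ w′∣Ψ → v∤Ψ (∣-trans v∣ww′
            (coprime-product∣ (coprime-factors (∣-trans ww′∣v v∣A)) w∣Ψ w′∣Ψ)))
        reduce : Dec (ProperDivisor v) → Result
        reduce (no irr) = e , v , v∣A , v∤Ψ , λ w 0<m m<e d → irr (_ , w , 0<m , m<e , d)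
        reduce (yes (m , w , 0<m , m<e , w∣v)) = reduceBy w 0<m m<e w∣v (w ∣? Ψ)

  module ResidueField {e} (v : Vec Carrier e) (irr : Irreducible v) where
    f : List Carrier
    f = monic v

    -- Euclid's algorithm: for m > 0 irreducibility makes the remainder of f by w nonzero. It is a
    -- unit times a monic polynomial of smaller degree, whose inverse modulo f yields one of w.
    monic-inverse : ∀ m (w : Vec Carrier m) → m ℕ.< e → ∃ λ y → f ∣ monic w ⊛ y P.- P.1#
    monic-inverse = <-rec Invertible step
      where
      Invertible : ℕ → Set
      Invertible m = (w : Vec Carrier m) → m ℕ.< e → ∃ λ y → f ∣ monic w ⊛ y P.- P.1#
      step : ∀ m → (∀ {n} → n ℕ.< m → Invertible n) → Invertible m
      step zero rec [] _ = P.1# , PT.1-inverse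
      step m@(suc _) rec w m<e = let Q , r , f≋ = divMod w f in from-normal Q r f≋ (normalise (toList r))
        where
        from-normal : ∀ Q (r : Vec Carrier m) → f ≋ Q ⊛ monic w ⊕ toList r → Normal (toList r) → ∃ λ y → f ∣ monic w ⊛ y P.- P.1#
        from-normal Q r f≋ (vanishes r≋[]) = ⊥-elim (irr w (ℕ.s≤s ℕ.z≤n) m<e (PT.quotient-remainder⇒∣ f≋ r≋[]))
        from-normal Q r f≋ (scaled {n} t u w′ ut≈1 n<r r≋) =
          let n<m = ≡.subst (n ℕ.<_) (length-toList r) n<r
              y , d = rec n<m w′ (ℕₚ.<-trans n<m m<e)
          in P.- (constant u ⊛ Q ⊛ y) , PT.inverse-from-remainder (≋-trans f≋ (P.+-congˡ r≋)) ut≈1 d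

    residue-inverse : ∀ p → ¬ (f ∣ p P.- P.0#) → ∃ λ y → f ∣ p ⊛ y P.- P.1#
    residue-inverse p f∤p = let Q , r , p≋ = divMod v p in from-normal Q r p≋ (normalise (toList r))
      where
      from-normal : ∀ Q (r : Vec Carrier e) → p ≋ Q ⊛ f ⊕ toList r → Normal (toList r) → ∃ λ y → f ∣ p ⊛ y P.- P.1#
      from-normal Q r p≋ (vanishes r≋[]) = ⊥-elim (f∤p (PT.∣⇒∣-0 (PT.quotient-remainder⇒∣ p≋ r≋[])))
      from-normal Q r p≋ (scaled {n} t u w ut≈1 n<r r≋) =
        let y , d = monic-inverse n w (≡.subst (n ℕ.<_) (length-toList r) n<r)
        in constant u ⊛ y , PT.inverse-mod (≋-trans p≋ (P.+-congˡ r≋)) ut≈1 d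

-- Bounding the degree of f by counting residues

funToFin-cong : ∀ {m n} {g h : Fin m → Fin n} → (∀ j → g j ≡ h j) → Fin.funToFin g ≡ Fin.funToFin h
funToFin-cong {zero}  eq = ≡.refl
funToFin-cong {suc m} eq = ≡.cong₂ Fin.combine (eq Fin.zero) (funToFin-cong (eq ∘ Fin.suc))

finToFun-injective : ∀ {m n} (k k′ : Fin (n ℕ.^ m)) → (∀ j → Fin.finToFun {n} {m} k j ≡ Fin.finToFun k′ j) → k ≡ k′
finToFun-injective {m} {n} k k′ eq = ≡.trans (≡.sym (Finₚ.funToFin-finToFin {m} {n} k))
  (≡.trans (funToFin-cong eq) (Finₚ.funToFin-finToFin {m} {n} k′))

module DegreeBound (F : FiniteField) where
  open FiniteField F
  open FiniteFieldTheory F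
  open FieldPolynomials F
  private module FT = RingTheory cring
  open import Algebra.Properties.Group +-group using (x∙y⁻¹≈ε⇒x≈y)

  1<size : 1 ℕ.< size
  1<size = two size (index 0#) (index 1#) (λ eq → 0≉1 (trans (sym (enum-index 0#)) (trans (reflexive (≡.cong enum eq)) (enum-index 1#))))
    where
    two : ∀ n (i j : Fin n) → ¬ (i ≡ j) → 1 ℕ.< n
    two 1 Fin.zero Fin.zero i≢j = ⊥-elim (i≢j ≡.refl)
    two (suc (suc n)) _ _ _ = ℕ.s≤s (ℕ.s≤s ℕ.z≤n)

  0<size^ : ∀ i → 0 ℕ.< size ℕ.^ i
  0<size^ i = ℕₚ.m^n>0 size {{ℕ.>-nonZero (ℕₚ.<-trans (ℕ.s≤s ℕ.z≤n) 1<size)}} i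

  constant-^ : ∀ c n → constant (c FT.^ n) ≋ constant c ^ n
  constant-^ c zero    = ≋-refl
  constant-^ c (suc n) = ≋-trans (constant-* c (c FT.^ n)) (P.*-congˡ (constant-^ c n))

  toList-minus : ∀ {m} (v w : Vec Carrier m) → toList v P.- toList w ≋ toList (Vec.zipWith (λ x y → x - y) v w)
  toList-minus v w = acts-equally λ a n → trans (act-⊕ (toList v) _ a n) (trans (+-congˡ (act-neg (toList w) a n)) (difference v w a n))
    where
    open DifferenceSolver cring
    difference : ∀ {m} (v w : Vec Carrier m) a n →
      act (toList v) a n - act (toList w) a n ≈ act (toList (Vec.zipWith (λ x y → x - y) v w)) a n
    difference []      []      a n = -‿inverseʳ 0#
    difference (c ∷ v) (d ∷ w) a n = trans
      (solve 5 (λ c d x s t → (c :* x :+ s) :- (d :* x :+ t) := (c :- d) :* x :+ (s :- t)) refl c d (a n) _ _)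
      (+-congˡ (difference v w a (suc n)))

  -- The difference of two representatives with at most e coefficients is again that short, so f
  -- divides it only if it is zero.
  small-residues-distinct : ∀ {e m} (v : Vec Carrier e) (g h : Fin m → Carrier) → m ℕ.≤ e →
    monic v ∣ toList (Vec.tabulate g) P.- toList (Vec.tabulate h) → ∀ j → g j ≈ h j
  small-residues-distinct v g h m≤e d = entries g h
    (monic∣small⇒zero v _ m≤e (∣-respʳ (toList-minus (Vec.tabulate g) (Vec.tabulate h)) d))
    where
    entries : ∀ {m} (g h : Fin m → Carrier) → AllZero (Vec.zipWith (λ x y → x - y) (Vec.tabulate g) (Vec.tabulate h)) → ∀ j → g j ≈ h j
    entries {suc m} g h (z ∷ _)  Fin.zero    = x∙y⁻¹≈ε⇒x≈y _ _ z
    entries {suc m} g h (_ ∷ zs) (Fin.suc j) = entries (g ∘ Fin.suc) (h ∘ Fin.suc) zs j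

  module _ {e} (v : Vec Carrier e) (irr : Irreducible v) (0<e : 0 ℕ.< e) where
    open ResidueField v irr

    K : CommutativeRing 0ℓ 0ℓ
    K = PT._/⟨_⟩ f
    module K = CommutativeRing K
    module KT = RingTheory K
    module KR = Roots K residue-inverse

    ^K≡^ : ∀ x n → x KT.^ n ≡ x ^ n
    ^K≡^ = ^-quotient polynomialRing f

    embed : ∀ {p q} → p ≋ q → p K.≈ q
    embed = PT.≈⇒∣-

    constant-fixed : ∀ c → constant c KT.^ size K.≈ constant c
    constant-fixed c = K.trans (K.reflexive (^K≡^ (constant c) size))
      (embed (≋-trans (≋-sym (constant-^ c size)) (constant-cong (fermat c))))

    -- The constants are `size` elements distinct modulo f, and Fermat gives (c + 1)^q = c + 1 = c^q
    -- + 1 for each of them; root counting extends additivity to all residues.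
    ^size-homo-+ : ∀ x y → (x K.+ y) KT.^ size K.≈ x KT.^ size K.+ y KT.^ size
    ^size-homo-+ = KR.^N-homo-+ (index 0#) (constant ∘ enum)
      (λ i j d → enum-inj i j (small-residues-distinct v (λ (_ : Fin 1) → enum i) (λ _ → enum j) 0<e d Fin.zero))
      (λ i → K.trans (KT.^-congˡ size (K.sym (embed (constant-+ (enum i) 1#))))
        (K.trans (constant-fixed (enum i + 1#)) (K.trans (embed (constant-+ (enum i) 1#))
          (K.+-congʳ (K.sym (constant-fixed (enum i)))))))
      (λ x → v ∣? (x P.- P.0#))

    ^sizeⁿ-homo-+ : ∀ n x y → (x K.+ y) KT.^ (size ℕ.^ n) K.≈ x KT.^ (size ℕ.^ n) K.+ y KT.^ (size ℕ.^ n)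
    ^sizeⁿ-homo-+ zero    x y = K.trans (K.*-identityʳ _) (K.+-cong (K.sym (K.*-identityʳ x)) (K.sym (K.*-identityʳ y)))
    ^sizeⁿ-homo-+ (suc n) x y = K.trans (K.sym (KT.^-assocʳ (x K.+ y) size (size ℕ.^ n)))
      (K.trans (KT.^-congˡ (size ℕ.^ n) (^size-homo-+ x y))
        (K.trans (^sizeⁿ-homo-+ n (x KT.^ size) (y KT.^ size))
          (K.+-cong (KT.^-assocʳ x size (size ℕ.^ n)) (KT.^-assocʳ y size (size ℕ.^ n)))))

    constant-fixedⁿ : ∀ n c → constant c KT.^ (size ℕ.^ n) K.≈ constant c
    constant-fixedⁿ zero    c = K.*-identityʳ _
    constant-fixedⁿ (suc n) c = K.trans (K.sym (KT.^-assocʳ (constant c) size (size ℕ.^ n)))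
      (K.trans (KT.^-congˡ (size ℕ.^ n) (constant-fixed c)) (constant-fixedⁿ n c))

    module _ {i d} (d∣ : d ℕ∣ size ℕ.^ i ℕ.∸ 1) (f∣ : f ∣ X ^ d P.- P.1#) where

      X-fixed : X KT.^ (size ℕ.^ i) K.≈ X
      X-fixed = lemma (size ℕ.^ i) (0<size^ i) d∣
        where
        -- With q^i generalised to N, matching N as a successor shows X^N = X · X^(N-1), where d
        -- divides N - 1.
        lemma : ∀ N → 0 ℕ.< N → d ℕ∣ N ℕ.∸ 1 → X KT.^ N K.≈ X
        lemma (suc N) _ (ℕ∣.divides k ≡.refl) = K.trans
          (K.*-congˡ (Order.^-multiple≈1 K d k (K.trans (K.reflexive (^K≡^ X d)) f∣))) (K.*-identityʳ X)

      -- The power q^i is additive and multiplicative and fixes X and the constants; Horner's scheme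
      -- carries this to every polynomial.
      all-fixed : ∀ p → p KT.^ (size ℕ.^ i) K.≈ p
      all-fixed [] = lemma (size ℕ.^ i) (0<size^ i)
        where
        lemma : ∀ N → 0 ℕ.< N → K.0# KT.^ N K.≈ K.0#
        lemma (suc N) _ = K.zeroˡ _
      all-fixed (c ∷ p) = K.trans (KT.^-congˡ N (embed (∷≋ c p)))
        (K.trans (^sizeⁿ-homo-+ i (constant c) (X ⊛ p))
          (K.trans (K.+-cong (constant-fixedⁿ i c) (K.trans (KT.^-distrib-* X p N) (K.*-cong X-fixed (all-fixed p))))
            (K.sym (embed (∷≋ c p)))))
        where N = size ℕ.^ i

      0≉1-residue : ¬ (K.0# K.≈ K.1#)
      0≉1-residue d = ℕₚ.<⇒≱ 0<e (monic-degree-≤ 0≉1 v [] (PT.∣-0 (K.sym d)))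

      degree≤ : 0 ℕ.< i → e ℕ.≤ i
      degree≤ 0<i = ℕₚ.≮⇒≥ λ i<e → ℕₚ.<⇒≱ (ℕₚ.^-monoʳ-< size 1<size i<e)
        (KR.fixed-points≤ 0≉1-residue 2≤ residue residue-inj (all-fixed ∘ residue))
        where
        residue : Fin (size ℕ.^ e) → List Carrier
        residue k = toList (Vec.tabulate (enum ∘ Fin.finToFun {size} {e} k))
        residue-inj : ∀ k k′ → residue k K.≈ residue k′ → k ≡ k′
        residue-inj k k′ d = finToFun-injective {e} {size} k k′ λ j → enum-inj _ _
          (small-residues-distinct v (enum ∘ Fin.finToFun {size} {e} k) (enum ∘ Fin.finToFun k′) ℕₚ.≤-refl d j)
        2≤ : 2 ℕ.≤ size ℕ.^ i
        2≤ = ℕₚ.≤-trans (≡.subst (2 ℕ.≤_) (≡.sym (ℕₚ.*-identityʳ size)) 1<size) (ℕₚ.^-monoʳ-≤ size {{ℕ.>-nonZero (ℕₚ.<-trans (ℕ.s≤s ℕ.z≤n) 1<size)}} 0<i)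

-- Constant terms, which control the condition on the first recurrence coefficient

module ConstantTerm (F : FiniteField) where
  open FiniteField F
  open FieldPolynomials F
  open Roots cring inverse using (*-cancel-0)
  open import Relation.Binary.Reasoning.Setoid setoid

  δ : Seq
  δ = nth (1# ∷ [])

  -- Reading the first coefficient through the action on 1, 0, 0, ... makes it invariant under ≋ by
  -- construction.
  constantTerm : List Carrier → Carrier
  constantTerm p = act p δ 0

  constantTerm-∷ : ∀ c p → constantTerm (c ∷ p) ≈ c
  constantTerm-∷ c p = trans (+-cong (*-identityʳ c) (trans (sym (act-shift p δ 0)) (act-zero p 0))) (+-identityʳ c)

  -- The shift kills `δ`, so q sends `δ` to `δ` times the constant term of q.
  constantTerm-⊛ : ∀ p q → constantTerm (p ⊛ q) ≈ constantTerm p * constantTerm q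
  constantTerm-⊛ p q = begin
    act (p ⊛ q) δ 0                        ≈⟨ act-⊛ p q δ 0 ⟩
    act p (act q δ) 0                      ≈⟨ act-cong p scaled-δ 0 ⟩
    act p (λ n → constantTerm q * δ n) 0   ≈⟨ act-* p (constantTerm q) δ 0 ⟩
    constantTerm q * constantTerm p        ≈⟨ *-comm _ _ ⟩
    constantTerm p * constantTerm q        ∎
    where
    scaled-δ : ∀ n → act q δ n ≈ constantTerm q * δ n
    scaled-δ zero    = sym (*-identityʳ _)
    scaled-δ (suc n) = trans (sym (act-shift q δ n)) (trans (act-zero q n) (sym (zeroʳ _)))

  ConstantTerm≉0 : List Carrier → Set
  ConstantTerm≉0 p = ¬ (constantTerm p ≈ 0#)

  ∣⇒constantTerm≉0 : ∀ {p q} → p ∣ q → ConstantTerm≉0 q → ConstantTerm≉0 p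
  ∣⇒constantTerm≉0 {p} (h , eq) q≉0 p≈0 =
    q≉0 (trans (sym (at eq δ 0)) (trans (constantTerm-⊛ h p) (trans (*-congˡ p≈0) (zeroʳ _))))

  ⊛-constantTerm≉0 : ∀ {p q} → ConstantTerm≉0 p → ConstantTerm≉0 q → ConstantTerm≉0 (p ⊛ q)
  ⊛-constantTerm≉0 {p} {q} p≉0 q≉0 eq = q≉0 (*-cancel-0 p≉0 (trans (sym (constantTerm-⊛ p q)) eq))

  ^-constantTerm≉0 : ∀ {p} n → ConstantTerm≉0 p → ConstantTerm≉0 (p ^ n)
  ^-constantTerm≉0 zero    p≉0 eq = 0≉1 (sym (trans (sym (constantTerm-∷ 1# [])) eq))
  ^-constantTerm≉0 (suc n) p≉0    = ⊛-constantTerm≉0 p≉0 (^-constantTerm≉0 n p≉0)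

  -1≉0 : ¬ (- 1# ≈ 0#)
  -1≉0 eq = 0≉1 (sym (trans (sym (+-identityʳ 1#)) (trans (+-congˡ (sym eq)) (-‿inverseʳ 1#))))

  X^-1-constantTerm≉0 : ∀ {m} → 0 ℕ.< m → ConstantTerm≉0 (X ^ m P.- P.1#)
  X^-1-constantTerm≉0 {suc m} _ eq = -1≉0 (trans (sym (+-identityˡ _)) (trans (sym (act-X^-1 (suc m) δ 0)) eq))

-- An irreducible factor of X^d - 1 modulo which X has order d

-- Φ = ∏ (X^(d/ℓ) − 1) over the primes ℓ ∣ d. Applied to the indicator τ of dℕ, evaluated at 0,
-- only the constant term of Φ contributes, because no nonempty sum of distinct d/ℓ is divisible by d.
module PrimitiveFactor (F : FiniteField) {d : ℕ} (0<d : 0 ℕ.< d) where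
  open FiniteField F
  open FieldPolynomials F
  open ConstantTerm F
  open import Relation.Binary.Reasoning.Setoid setoid
  open import Algebra.Properties.Semiring.Mult semiring using () renaming (_×_ to _·_)
  open import Algebra.Properties.Ring ring using (-0#≈0#)
  open import Algebra.Properties.Group +-group using (⁻¹-involutive)

  indicator : ∀ {A : Set} → Dec A → Carrier
  indicator (yes _) = 1#
  indicator (no _)  = 0#

  indicator-yes : ∀ {A : Set} (A? : Dec A) → A → indicator A? ≈ 1#
  indicator-yes (yes _) a = refl
  indicator-yes (no ¬a) a = ⊥-elim (¬a a)

  indicator-no : ∀ {A : Set} (A? : Dec A) → ¬ A → indicator A? ≈ 0#
  indicator-no (yes a) ¬a = ⊥-elim (¬a a)
  indicator-no (no _)  ¬a = refl

  indicator-cong : ∀ {A B : Set} (A? : Dec A) (B? : Dec B) → (A → B) → (B → A) → indicator A? ≈ indicator B?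
  indicator-cong (yes a) B? f g = sym (indicator-yes B? (f a))
  indicator-cong (no ¬a) B? f g = sym (indicator-no B? (¬a ∘ g))

  τ : Seq
  τ n = indicator (d ℕ∣.∣? n)

  τ-periodic : ∀ n → τ (n ℕ.+ d) ≈ τ n
  τ-periodic n = indicator-cong (d ℕ∣.∣? (n ℕ.+ d)) (d ℕ∣.∣? n)
    (λ x → ∣m+n∣n⇒∣m n d x ℕ∣.∣-refl) (λ x → ℕ∣.∣m∣n⇒∣m+n x ℕ∣.∣-refl)

  primeDivisor? : ∀ ℓ → Dec (Prime ℓ × ℓ ℕ∣ d)
  primeDivisor? ℓ = prime? ℓ ×-dec (ℓ ℕ∣.∣? d)

  φ : ∀ {ℓ} → Dec (Prime ℓ × ℓ ℕ∣ d) → List Carrier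
  φ (yes (_ , ℕ∣.divides k _)) = X ^ k P.- P.1#
  φ (no _)                     = P.1#

  Φ : ℕ → List Carrier
  Φ zero    = P.1#
  Φ (suc n) = φ (primeDivisor? n) ⊛ Φ n

  act-1 : ∀ a n → act P.1# a n ≈ a n
  act-1 a n = trans (+-identityʳ _) (*-identityˡ _)

  -- `τ` lives on multiples of d, hence of ℓ^a. The factors of `Φ n` belong to primes n′ < ℓ, and
  -- their shifts d/n′ are still multiples of ℓ^a, so the support stays among these multiples.
  Φ-vanishes : ∀ {ℓ} → Prime ℓ → ∀ a → ℓ ℕ.^ a ℕ∣ d → ∀ n → n ℕ.≤ ℓ → ∀ m → ¬ (ℓ ℕ.^ a ℕ∣ m) → act (Φ n) τ m ≈ 0#
  Φ-vanishes pr a ℓᵃ∣d zero    n≤ℓ m ∤m = trans (act-1 τ m) (indicator-no (d ℕ∣.∣? m) (λ d∣m → ∤m (ℕ∣.∣-trans ℓᵃ∣d d∣m)))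
  Φ-vanishes {ℓ} pr a ℓᵃ∣d (suc n) n<ℓ m ∤m = trans (act-⊛ (φ (primeDivisor? n)) (Φ n) τ m) (factor (primeDivisor? n))
    where
    b = act (Φ n) τ
    b≈0 : ∀ m → ¬ (ℓ ℕ.^ a ℕ∣ m) → b m ≈ 0#
    b≈0 = Φ-vanishes pr a ℓᵃ∣d n (ℕₚ.<⇒≤ n<ℓ)
    factor : (D : Dec (Prime n × n ℕ∣ d)) → act (φ D) b m ≈ 0#
    factor (no _) = trans (act-1 b m) (b≈0 m ∤m)
    factor (yes (pr′ , ℕ∣.divides k d≡kn)) = trans (act-X^-1 k b m)
      (trans (+-cong (b≈0 (m ℕ.+ k) (λ ∣m+k → ∤m (∣m+n∣n⇒∣m m k ∣m+k ∣k))) (-‿cong (b≈0 m ∤m))) (-‿inverseʳ 0#))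
      where
      ∣k : ℓ ℕ.^ a ℕ∣ k
      ∣k = ^∣*-cancelʳ pr (λ ℓ∣n → ℕₚ.<⇒≢ n<ℓ (≡.sym (prime∣prime⇒≡ pr pr′ ℓ∣n))) a k (≡.subst (ℓ ℕ.^ a ℕ∣_) d≡kn ℓᵃ∣d)

  -- Adjoining a prime n replaces the value b(0) by b(d/n) - b(0). The full power of n in d does not
  -- divide d/n, so b(d/n) = 0 and only the sign changes.
  Φ-nonvanishing : ∀ n → ¬ (act (Φ n) τ 0 ≈ 0#)
  Φ-nonvanishing zero    eq = 0≉1 (sym (trans (sym (indicator-yes (d ℕ∣.∣? 0) (d ℕ∣.∣0))) (trans (sym (act-1 τ 0)) eq)))
  Φ-nonvanishing (suc n) eq = Φ-nonvanishing n (factor (primeDivisor? n) (trans (sym (act-⊛ (φ (primeDivisor? n)) (Φ n) τ 0)) eq))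
    where
    b = act (Φ n) τ
    factor : (D : Dec (Prime n × n ℕ∣ d)) → act (φ D) b 0 ≈ 0# → b 0 ≈ 0#
    factor (no _) eq = trans (sym (act-1 b 0)) eq
    factor (yes (pr , ℕ∣.divides k d≡kn)) eq = begin
      b 0            ≈⟨ ⁻¹-involutive _ ⟨
      - - b 0        ≈⟨ -‿cong (+-identityˡ _) ⟨
      - (0# - b 0)   ≈⟨ -‿cong (+-congʳ b-k≈0) ⟨
      - (b k - b 0)  ≈⟨ -‿cong (trans (sym (act-X^-1 k b 0)) eq) ⟩
      - 0#           ≈⟨ -0#≈0# ⟩
      0#             ∎
      where
      b-k≈0 : b k ≈ 0#
      b-k≈0 = let a , u , d≡ , n∤u = valuation pr d 0<d in
        Φ-vanishes pr a (ℕ∣.divides u (≡.trans d≡ (ℕₚ.*-comm (n ℕ.^ a) u))) n ℕₚ.≤-refl k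
          (λ nᵃ∣k → n∤u (ℕ∣.*-cancelˡ-∣ (n ℕ.^ a) {{ℕₚ.m^n≢0 n a {{prime⇒nonZero pr}}}}
            (≡.subst (n ℕ.^ a ℕ.* n ℕ∣_) (≡.trans (≡.sym d≡kn) d≡) (ℕ∣.*-monoˡ-∣ n nᵃ∣k))))

  Φ-contains : ∀ {ℓ k} → Prime ℓ → d ≡ k ℕ.* ℓ → ∀ n → ℓ ℕ.< n → X ^ k P.- P.1# ∣ Φ n
  Φ-contains {ℓ} {k} pr d≡kℓ (suc n) (ℕ.s≤s ℓ≤n) = cases (ℕₚ.m≤n⇒m<n∨m≡n ℓ≤n)
    where
    factor : (D : Dec (Prime ℓ × ℓ ℕ∣ d)) → X ^ k P.- P.1# ∣ φ D
    factor (no ¬D) = ⊥-elim (¬D (pr , ℕ∣.divides k d≡kℓ))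
    -- The decision procedure carries its own quotient; cancelling ℓ identifies it with k.
    factor (yes (_ , ℕ∣.divides k′ d≡k′ℓ)) = ≡.subst (λ m → X ^ k P.- P.1# ∣ X ^ m P.- P.1#)
      (ℕₚ.*-cancelʳ-≡ k k′ ℓ {{prime⇒nonZero pr}} (≡.trans (≡.sym d≡kℓ) d≡k′ℓ)) ∣-refl
    cases : ℓ ℕ.< n ⊎ ℓ ≡ n → X ^ k P.- P.1# ∣ Φ (suc n)
    cases (inj₁ ℓ<n)    = ∣-*ˡ (φ (primeDivisor? n)) (Φ-contains {k = k} pr d≡kℓ n ℓ<n)
    cases (inj₂ ≡.refl) = ∣-*ʳ (Φ n) (factor (primeDivisor? n))

  -- X^d - 1 kills the d-periodic `τ`, and so would each of its multiples, while `Φ n` takes a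
  -- nonzero value on `τ` at 0.
  X^d-1∤Φ : ∀ n → ¬ (X ^ d P.- P.1# ∣ Φ n)
  X^d-1∤Φ n (h , eq) = Φ-nonvanishing n (begin
    act (Φ n) τ 0                           ≈⟨ at eq τ 0 ⟨
    act (h ⊛ (X ^ d P.- P.1#)) τ 0          ≈⟨ act-⊛ h (X ^ d P.- P.1#) τ 0 ⟩
    act h (act (X ^ d P.- P.1#) τ) 0        ≈⟨ act-cong h (λ m → trans (act-X^-1 d τ m) (trans (+-congʳ (τ-periodic m)) (-‿inverseʳ _))) 0 ⟩
    act h (λ _ → 0#) 0                      ≈⟨ act-zero h 0 ⟩
    0#                                      ∎)

  module _ (d-invertible : ∃ λ ν⁻¹ → ν⁻¹ * (d · 1#) ≈ 1#) where

    coprime-factors : ∀ {p q} → p ⊛ q ∣ X ^ d P.- P.1# → Coprime p q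
    coprime-factors {p} {q} (h , eq) = coprime-*ʳ (X^-1-coprime-factors d
      (≋-trans (≋-sym (P.*-assoc p q h)) (≋-trans (P.*-comm (p ⊛ q) h) eq)) d-invertible)

    PrimitiveFactor : Set
    PrimitiveFactor = ∃₂ λ e (v : Vec Carrier e) → 0 ℕ.< e × Irreducible v × monic v ∣ X ^ d P.- P.1# ×
                      (∀ m → monic v ∣ X ^ m P.- P.1# → d ℕ∣ m)

    exact-order : ∀ {e} (v : Vec Carrier e) → monic v ∣ X ^ d P.- P.1# → ¬ (monic v ∣ Φ (suc d)) →
                ∀ m → monic v ∣ X ^ m P.- P.1# → d ℕ∣ m
    exact-order v v∣ v∤Φ m v∣m = Order.order-∣ K 0<d (power≈1 d v∣)
      -- X^(d/ℓ) ≡ 1 would make v a divisor of X^(d/ℓ) - 1, which divides `Φ (suc d)` because a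
      -- prime divisor ℓ of d is at most d.
      (λ ℓ k pr d≡ eq → v∤Φ (∣-trans (K.trans (K.reflexive (≡.sym (^K≡^ X k))) eq)
        (Φ-contains {k = k} pr d≡ (suc d) (ℕ.s≤s (ℕ∣.∣⇒≤ {{ℕ.>-nonZero 0<d}} (ℕ∣.divides k d≡))))))
      m (power≈1 m v∣m)
      where
      K = PT._/⟨_⟩ (monic v)
      module K = CommutativeRing K
      ^K≡^ = ^-quotient polynomialRing (monic v)
      power≈1 : ∀ n → monic v ∣ X ^ n P.- P.1# → RingTheory._^_ K X n K.≈ K.1#
      power≈1 n v∣ = K.trans (K.reflexive (^K≡^ X n)) v∣

    primitiveFactor : PrimitiveFactor
    primitiveFactor = from-normal (normalise (X ^ d P.- P.1#))
      where
      positive : ∀ {e} (v : Vec Carrier e) → ¬ (monic v ∣ Φ (suc d)) → 0 ℕ.< e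
      -- The monic polynomial of degree 0 is 1 and divides everything.
      positive []      v∤Φ = ⊥-elim (v∤Φ (Φ (suc d) , P.*-identityʳ _))
      positive (_ ∷ _) v∤Φ = ℕ.s≤s ℕ.z≤n
      from-normal : Normal (X ^ d P.- P.1#) → PrimitiveFactor
      from-normal (vanishes eq) = ⊥-elim (X^-1-constantTerm≉0 0<d (at eq δ 0))
      from-normal (scaled {n} t u v ut≈1 _ eq) =
        let e , v′ , v′∣ , v′∤Φ , irr = irreducible-factor-avoiding (X ^ d P.- P.1#) (Φ (suc d)) coprime-factors n v
              (constant t , ≋-sym eq) (λ v∣Φ → X^d-1∤Φ (suc d) (∣-trans (PT.unit-multiple-∣ ut≈1 (≋-sym eq)) v∣Φ))
        in e , v′ , positive v′ v′∤Φ , irr , v′∣ , exact-order v′ v′∣ v′∤Φ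

-- Multiplicities in X^m - 1 and the order of powers of f

module PeriodOfPower (F : FiniteField) {p} (pr : Prime p) (p≈0 : HasChar F p) where
  open FiniteField F
  open FiniteFieldTheory F
  open FieldPolynomials F
  open DegreeBound F using (0<size^)
  open Roots cring inverse using (*-cancel-0)
  open import Relation.Binary.Reasoning.Setoid setoid
  open import Algebra.Properties.Semiring.Mult semiring using (×1-homo-*; ×-homo-+) renaming (_×_ to _·_)
  open import Algebra.Properties.Semiring.Mult P.semiring using () renaming (_×_ to _·ₚ_)

  natMul≡· : ∀ n → natMul F n ≡ n · 1#
  natMul≡· zero    = ≡.refl
  natMul≡· (suc n) = ≡.cong (1# +_) (natMul≡· n)

  p·1≈0 : p · 1# ≈ 0#
  p·1≈0 = trans (reflexive (≡.sym (natMul≡· p))) p≈0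

  ·1-multiple≈0 : ∀ k n → n · 1# ≈ 0# → (k ℕ.* n) · 1# ≈ 0#
  ·1-multiple≈0 k n eq = trans (×1-homo-* k n) (trans (*-congˡ eq) (zeroʳ _))

  -- gcd(n, p) = 1, so by Bézout n · 1 = 0 and p · 1 = 0 would give 1 = 0.
  p∤⇒·1≉0 : ∀ n → ¬ (p ℕ∣ n) → ¬ (n · 1# ≈ 0#)
  p∤⇒·1≉0 n p∤n n≈0 = 0≉1 (sym (trans (sym (+-identityʳ 1#)) (≡.subst (λ g → g · 1# ≈ 0#) gcd≡1 gcd·1≈0)))
    where
    gcd≡1 : gcd n p ≡ 1
    gcd≡1 with prime⇒irreducible pr (gcd[m,n]∣n n p)
    ... | inj₁ eq = eq
    ... | inj₂ eq = ⊥-elim (p∤n (≡.subst (_ℕ∣ n) eq (gcd[m,n]∣m n p)))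
    difference : ∀ g b {c} → g ℕ.+ b ≡ c → b · 1# ≈ 0# → c · 1# ≈ 0# → g · 1# ≈ 0#
    difference g b ≡.refl b≈0 c≈0 = begin
      g · 1#             ≈⟨ +-identityʳ _ ⟨
      g · 1# + 0#        ≈⟨ +-congˡ b≈0 ⟨
      g · 1# + b · 1#    ≈⟨ ×-homo-+ 1# g b ⟨
      (g ℕ.+ b) · 1#     ≈⟨ c≈0 ⟩
      0#                 ∎
    gcd·1≈0 : gcd n p · 1# ≈ 0#
    gcd·1≈0 with Bézout.identity (gcd-GCD n p)
    ... | Bézout.+- s t eq = difference _ (t ℕ.* p) eq (·1-multiple≈0 t p p·1≈0) (·1-multiple≈0 s n n≈0)
    ... | Bézout.-+ s t eq = difference _ (s ℕ.* n) eq (·1-multiple≈0 s n n≈0) (·1-multiple≈0 t p p·1≈0)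

  -- Since q · 1 = 0 and q^i = k d + 1, d · 1 = 0 would give 1 = 0. The separability of X^d - 1
  -- rests on this.
  ∣size^-1⇒·1≉0 : ∀ {i d} → 0 ℕ.< i → d ℕ∣ size ℕ.^ i ∸ 1 → ¬ (d · 1# ≈ 0#)
  ∣size^-1⇒·1≉0 {suc i} {d} _ d∣ d≈0 = lemma (size ℕ.^ suc i) (0<size^ (suc i)) d∣
    (trans (reflexive (≡.cong (_· 1#) (ℕₚ.*-comm size (size ℕ.^ i)))) (·1-multiple≈0 (size ℕ.^ i) size size·1≈0))
    where
    lemma : ∀ N → 0 ℕ.< N → d ℕ∣ N ∸ 1 → ¬ (N · 1# ≈ 0#)
    lemma (suc N) _ (ℕ∣.divides k ≡.refl) N≈0 =
      0≉1 (sym (trans (sym (+-identityʳ 1#)) (trans (+-congˡ (sym (·1-multiple≈0 k d d≈0))) N≈0)))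

  p·1≋0 : p ·ₚ P.1# ≋ P.0#
  p·1≋0 = ≋-trans (multiple p) (acts-equally λ a n → trans (+-identityʳ _) (trans (*-congʳ p·1≈0) (zeroˡ _)))
    where
    multiple : ∀ n → n ·ₚ P.1# ≋ constant (n · 1#)
    multiple zero    = acts-equally λ a n → sym (trans (+-identityʳ _) (zeroˡ _))
    multiple (suc n) = ≋-trans (P.+-congˡ (multiple n)) (≋-sym (constant-+ 1# (n · 1#)))

  X^-1-Frobenius : ∀ n b → (X ^ n P.- P.1#) ^ (p ℕ.^ b) ≋ X ^ (n ℕ.* p ℕ.^ b) P.- P.1#
  X^-1-Frobenius n b = ≋-trans (PT.Frobenius.^pⁿ-minus-1 pr p·1≋0 b (X ^ n)) (P.+-congʳ (PT.^-assocʳ X n (p ℕ.^ b)))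

  ^-mono-∣ : ∀ f {s t} → s ℕ.≤ t → f ^ s ∣ f ^ t
  ^-mono-∣ f {s} {t} s≤t = f ^ (t ∸ s) , ≋-trans (≋-sym (PT.^-homo-* f (t ∸ s) s)) (PT.^-congʳ f (ℕₚ.m∸n+n≡m s≤t))

  module _ {e d} (v : Vec Carrier e) (0<e : 0 ℕ.< e) (v∣ : monic v ∣ X ^ d P.- P.1#)
           (order : ∀ m → monic v ∣ X ^ m P.- P.1# → d ℕ∣ m) (d≉0 : ¬ (d · 1# ≈ 0#)) where

    f = monic v

    f∣X^multiple : ∀ k → f ∣ X ^ (k ℕ.* d) P.- P.1#
    f∣X^multiple k = K.trans (K.reflexive (≡.sym (^-quotient polynomialRing f X (k ℕ.* d))))
      (Order.^-multiple≈1 K d k (K.trans (K.reflexive (^-quotient polynomialRing f X d)) v∣))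
      where
      K = PT._/⟨_⟩ f
      module K = CommutativeRing K

    f^∣ : ∀ {s j} → s ℕ.≤ p ℕ.^ j → f ^ s ∣ X ^ (p ℕ.^ j ℕ.* d) P.- P.1#
    f^∣ {s} {j} s≤ = ≡.subst (λ m → f ^ s ∣ X ^ m P.- P.1#) (ℕₚ.*-comm d (p ℕ.^ j))
      (∣-trans (^-mono-∣ f s≤) (∣-respʳ (X^-1-Frobenius d j) (PT.∣-pow (p ℕ.^ j) v∣)))

    -- X^n − 1 is separable for p ∤ n, so f occurs in (X^n − 1)^(p^b) with multiplicity exactly p^b.
    multiplicity : ∀ {s} b w → ¬ (p ℕ∣ w) → f ^ s ∣ X ^ (w ℕ.* d ℕ.* p ℕ.^ b) P.- P.1# → s ℕ.≤ p ℕ.^ b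
    multiplicity {s} b w p∤w f^s∣ = ℕₚ.≮⇒≥ λ q<s → too-many (∣-trans (^-mono-∣ f q<s) (∣-respʳ (≋-sym (X^-1-Frobenius n b)) f^s∣))
      where
      n = w ℕ.* d
      q = p ℕ.^ b
      n≉0 : ¬ (n · 1# ≈ 0#)
      n≉0 eq = d≉0 (*-cancel-0 (p∤⇒·1≉0 w p∤w) (trans (sym (×1-homo-* w d)) eq))
      n⁻¹ : ∃ λ ν⁻¹ → ν⁻¹ * (n · 1#) ≈ 1#
      n⁻¹ = let u , eq = inverse (n · 1#) n≉0 in u , trans (*-comm _ _) eq
      too-many : ¬ (f ^ suc q ∣ (X ^ n P.- P.1#) ^ q)
      too-many (g , g-eq) = excess (f∣X^multiple w) (monic-^ v q)
        where
        -- With X^n - 1 = h f, cancelling f^q from g f^(q+1) = h^q f^q leaves f ∣ h^q. As f and h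
        -- are coprime, f would divide 1.
        excess : f ∣ X ^ n P.- P.1# → (∃ λ (u : Vec Carrier (q ℕ.* e)) → f ^ q ≋ monic u) → _
        excess (h , hf≋) (u , f^q≋u) = ℕₚ.<⇒≱ 0<e (monic-degree-≤ 0≉1 v []
          (PT.coprime∣^⇒∣1 q (X^-1-coprime-factors n (≋-trans (P.*-comm f h) hf≋) n⁻¹) (g , monic-cancelʳ u cancelled)))
          where
          cancelled : (g ⊛ f) ⊛ monic u ≋ h ^ q ⊛ monic u
          cancelled = ≋-trans (P.*-congˡ (≋-sym f^q≋u)) (≋-trans (P.*-assoc g f (f ^ q)) (≋-trans g-eq
            (≋-trans (PT.^-congˡ q (≋-sym hf≋)) (≋-trans (PT.^-distrib-* h f q) (P.*-congˡ f^q≋u)))))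

    -- f itself divides X^m - 1, so m = c d; write c = p^b w with p ∤ w. The multiplicity bound
    -- gives s ≤ p^b, whence j ≤ b and p^j divides c.
    f^-order : ∀ {s j} → 0 ℕ.< s → (∀ b → s ℕ.≤ p ℕ.^ b → j ℕ.≤ b) →
               ∀ m → 0 ℕ.< m → f ^ s ∣ X ^ m P.- P.1# → p ℕ.^ j ℕ.* d ℕ∣ m
    f^-order {s} {j} 0<s minimal m 0<m f^s∣ = go (order m (∣-trans f∣f^s f^s∣))
      where
      f∣f^s : f ∣ f ^ s
      f∣f^s = ∣-trans (P.1# , ≋-trans (P.*-identityˡ _) (≋-sym (P.*-identityʳ f))) (^-mono-∣ f 0<s)
      p^-mono-∣ : ∀ {b} → j ℕ.≤ b → p ℕ.^ j ℕ∣ p ℕ.^ b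
      p^-mono-∣ {b} j≤b = ℕ∣.divides (p ℕ.^ (b ∸ j))
        (≡.trans (≡.cong (p ℕ.^_) (≡.sym (ℕₚ.m∸n+n≡m j≤b))) (ℕₚ.^-distribˡ-+-* p (b ∸ j) j))
      go : d ℕ∣ m → p ℕ.^ j ℕ.* d ℕ∣ m
      go (ℕ∣.divides zero ≡.refl) = ⊥-elim (ℕₚ.n≮0 0<m)
      go (ℕ∣.divides c@(suc _) ≡.refl) =
        let b , w , c≡ , p∤w = valuation pr c (ℕ.s≤s ℕ.z≤n)
            c*d≡ = ≡.trans (≡.cong (ℕ._* d) (≡.trans c≡ (ℕₚ.*-comm (p ℕ.^ b) w)))
                     (≡.trans (ℕₚ.*-assoc w (p ℕ.^ b) d) (≡.trans (≡.cong (w ℕ.*_) (ℕₚ.*-comm (p ℕ.^ b) d)) (≡.sym (ℕₚ.*-assoc w d (p ℕ.^ b)))))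
            s≤ = multiplicity b w p∤w (≡.subst (λ n → f ^ s ∣ X ^ n P.- P.1#) c*d≡ f^s∣)
        in ℕ∣.*-monoˡ-∣ d (ℕ∣.∣-trans (p^-mono-∣ (minimal b s≤))
             (ℕ∣.divides w (≡.trans c≡ (ℕₚ.*-comm (p ℕ.^ b) w))))

-- From the order of a polynomial to the period of a sequence

module Realisation (F : FiniteField) where
  open FiniteField F
  open FieldPolynomials F
  open ConstantTerm F
  open import Relation.Binary.Reasoning.Setoid setoid
  open import Algebra.Properties.Ring ring using (-0#≈0#)
  open import Algebra.Properties.Group +-group using (x∙y⁻¹≈ε⇒x≈y; ⁻¹-involutive; x≈y⇒x∙y⁻¹≈ε)

  sumF-cong : ∀ n {g h : Fin n → Carrier} → (∀ i → g i ≈ h i) → sumF F n g ≈ sumF F n h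
  sumF-cong zero    eq = refl
  sumF-cong (suc n) eq = +-cong (eq Fin.zero) (sumF-cong n (eq ∘ Fin.suc))

  act-monic-sumF : ∀ {k} (x : Vec Carrier k) a n →
    a (n ℕ.+ k) ≈ sumF F k (λ i → - Vec.lookup x i * a (n ℕ.+ Fin.toℕ i)) + act (monic x) a n
  act-monic-sumF []      a n = trans (reflexive (≡.cong a (ℕₚ.+-identityʳ n))) (sym (trans (+-identityˡ _) (trans (+-identityʳ _) (*-identityˡ _))))
  act-monic-sumF {suc k} (c ∷ x) a n = begin
    a (n ℕ.+ suc k)
      ≈⟨ reflexive (≡.cong a (ℕₚ.+-suc n k)) ⟩
    a (suc n ℕ.+ k)
      ≈⟨ act-monic-sumF x a (suc n) ⟩
    sumF F k (λ i → - Vec.lookup x i * a (suc n ℕ.+ Fin.toℕ i)) + act (monic x) a (suc n)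
      ≈⟨ +-congʳ (sumF-cong k (λ i → *-congˡ (reflexive (≡.cong a (≡.sym (ℕₚ.+-suc n (Fin.toℕ i))))))) ⟩
    S + T
      ≈⟨ solve 4 (λ c y s t → s :+ t := ((:- c) :* y :+ s) :+ (c :* y :+ t)) refl c (a n) S T ⟩
    (- c * a n + S) + (c * a n + T)
      ≈⟨ +-congʳ (+-congʳ (*-congˡ (reflexive (≡.cong a (≡.sym (ℕₚ.+-identityʳ n)))))) ⟩
    (- c * a (n ℕ.+ 0) + S) + (c * a n + T) ∎
    where
    open DifferenceSolver cring
    S = sumF F k (λ i → - Vec.lookup x i * a (n ℕ.+ Fin.toℕ (Fin.suc i)))
    T = act (monic x) a (suc n)

  ∣⇒annihilates : ∀ {q r} {a : Seq} → q ∣ r → (∀ n → act q a n ≈ 0#) → ∀ n → act r a n ≈ 0#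
  ∣⇒annihilates {q} {r} {a} (h , eq) q·a≈0 n = begin
    act r a n           ≈⟨ at eq a n ⟨
    act (h ⊛ q) a n     ≈⟨ act-⊛ h q a n ⟩
    act h (act q a) n   ≈⟨ act-cong h q·a≈0 n ⟩
    act h (λ _ → 0#) n  ≈⟨ act-zero h n ⟩
    0#                  ∎

  -- X^m - 1 annihilates the impulse response of u exactly when u divides it, so the order M of u is
  -- the least period of that sequence.
  order∈P : ∀ {D k M} (u : Vec Carrier D) → 0 ℕ.< D → D ℕ.≤ k → 0 ℕ.< M → monic u ∣ X ^ M P.- P.1# →
            (∀ m → 0 ℕ.< m → monic u ∣ X ^ m P.- P.1# → M ℕ∣ m) → InP F k M
  order∈P {suc D} {k} {M} u _ D≤k 0<M u∣ minimal =
    a , (λ i → - Vec.lookup x i) , c₀≉0 x (∣⇒constantTerm≉0 x∣ product≉0) , linRec , (0<M , 0 , λ n _ → periodic n) , least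
    where
    a = impulse u

    u·a≈0 : ∀ n → act (monic u) a n ≈ 0#
    u·a≈0 = Recurrence.run-solves u _ _

    -- The padding factor is X - 1: its constant term is nonzero, whereas a factor X would make the
    -- first recurrence coefficient vanish.
    L : List Carrier
    L = monic (- 1# ∷ [])

    padded : ∃ λ (x : Vec Carrier k) → monic u ⊛ L ^ (k ∸ suc D) ≋ monic x
    padded = let y , eq = monic-^ (- 1# ∷ []) (k ∸ suc D)
                 z , eq′ = monic-⊛ u y
             in ≡.subst (λ n → ∃ λ (x : Vec Carrier n) → monic u ⊛ L ^ (k ∸ suc D) ≋ monic x)
                  (≡.trans (≡.cong (suc D ℕ.+_) (ℕₚ.*-identityʳ (k ∸ suc D))) (ℕₚ.m+[n∸m]≡n D≤k))
                  (z , ≋-trans (P.*-congˡ eq) eq′)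

    x = proj₁ padded

    x∣ : monic x ∣ monic u ⊛ L ^ (k ∸ suc D)
    x∣ = ∣-respʳ (≋-sym (proj₂ padded)) ∣-refl

    -- u divides X^M - 1, whose constant term is -1.
    product≉0 : ConstantTerm≉0 (monic u ⊛ L ^ (k ∸ suc D))
    product≉0 = ⊛-constantTerm≉0 (∣⇒constantTerm≉0 u∣ (X^-1-constantTerm≉0 0<M))
      (^-constantTerm≉0 (k ∸ suc D) (λ eq → -1≉0 (trans (sym (constantTerm-∷ (- 1#) (1# ∷ []))) eq)))

    c₀≉0 : ∀ {k} (x : Vec Carrier k) → ConstantTerm≉0 (monic x) → ∀ z → Fin.toℕ z ≡ 0 → ¬ (- Vec.lookup x z ≈ 0#)
    c₀≉0 (c ∷ x) x≉0 Fin.zero _ eq =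
      x≉0 (trans (constantTerm-∷ c (monic x)) (trans (sym (⁻¹-involutive c)) (trans (-‿cong eq) -0#≈0#)))

    linRec : LinRec F k a (λ i → - Vec.lookup x i)
    linRec n = trans (act-monic-sumF x a n) (trans (+-congˡ
      (∣⇒annihilates (∣-respʳ (proj₂ padded) (∣-*ʳ (L ^ (k ∸ suc D)) ∣-refl)) u·a≈0 n)) (+-identityʳ _))

    periodic : ∀ n → a (n ℕ.+ M) ≈ a n
    periodic n = x∙y⁻¹≈ε⇒x≈y _ _ (trans (sym (act-X^-1 M a n)) (∣⇒annihilates u∣ u·a≈0 n))

    periodic* : ∀ t n → a (n ℕ.+ t ℕ.* M) ≈ a n
    periodic* zero    n = reflexive (≡.cong a (ℕₚ.+-identityʳ n))
    periodic* (suc t) n = trans (reflexive (≡.cong a (≡.sym (ℕₚ.+-assoc n M (t ℕ.* M)))))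
      (trans (periodic* t (n ℕ.+ M)) (periodic n))

    least : ∀ m → IsEventualPeriod F a m → M ℕ.≤ m
    least m (0<m , N , eventually) = ℕ∣.∣⇒≤ {{ℕ.>-nonZero 0<m}} (minimal m 0<m (impulse-annihilator u (X ^ m P.- P.1#)
      (λ n → trans (act-X^-1 m a n) (x≈y⇒x∙y⁻¹≈ε (pure n)))))
      where
      -- Adding N M moves n past the threshold N of the eventual period m, and the period M, valid
      -- from the start, brings it back.
      pure : ∀ n → a (n ℕ.+ m) ≈ a n
      pure n = begin
        a (n ℕ.+ m)                  ≈⟨ periodic* N (n ℕ.+ m) ⟨
        a (n ℕ.+ m ℕ.+ N ℕ.* M)      ≈⟨ reflexive (≡.cong a swap) ⟩
        a (n ℕ.+ N ℕ.* M ℕ.+ m)      ≈⟨ eventually (n ℕ.+ N ℕ.* M) (ℕₚ.≤-trans (ℕₚ.m≤m*n N M {{ℕ.>-nonZero 0<M}}) (ℕₚ.m≤n+m (N ℕ.* M) n)) ⟩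
        a (n ℕ.+ N ℕ.* M)            ≈⟨ periodic* N n ⟩
        a n                          ∎
        where
        swap : n ℕ.+ m ℕ.+ N ℕ.* M ≡ n ℕ.+ N ℕ.* M ℕ.+ m
        swap = ≡.trans (ℕₚ.+-assoc n m (N ℕ.* M)) (≡.trans (≡.cong (n ℕ.+_) (ℕₚ.+-comm m (N ℕ.* M))) (≡.sym (ℕₚ.+-assoc n (N ℕ.* M) m)))

-- For j > 0 the hypothesis at t = j - 1 gives p^(j-1) < ⌊k/i⌋, so s = p^(j-1) + 1 still satisfies s
-- i ≤ k. Lying just above p^(j-1), s has p^j as the least power of p that reaches it.
exponent : ∀ {p} → Prime p → ∀ k i {{_ : NonZero i}} → i ℕ.≤ k → ∀ j → (∀ t → k / i ℕ.≤ p ℕ.^ t → j ℕ.≤ t) →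
           ∃ λ s → 0 ℕ.< s × s ℕ.≤ p ℕ.^ j × (∀ b → s ℕ.≤ p ℕ.^ b → j ℕ.≤ b) × s ℕ.* i ℕ.≤ k
exponent pr k i i≤k zero    j≤ = 1 , ℕ.s≤s ℕ.z≤n , ℕₚ.≤-refl , (λ _ _ → ℕ.z≤n) , ≡.subst (ℕ._≤ k) (≡.sym (ℕₚ.*-identityˡ i)) i≤k
exponent {p} pr k i i≤k (suc j) j≤ =
  suc (p ℕ.^ j) , ℕ.s≤s ℕ.z≤n , ℕₚ.^-monoʳ-< p 1<p (ℕₚ.n<1+n j) ,
  (λ b s≤ → ℕₚ.≰⇒> λ b≤j → ℕₚ.<⇒≱ s≤ (ℕₚ.^-monoʳ-≤ p {{prime⇒nonZero pr}} b≤j)) ,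
  ℕₚ.≤-trans (ℕₚ.*-monoˡ-≤ i (ℕₚ.≰⇒> λ k/i≤ → ℕₚ.<-irrefl ≡.refl (j≤ j k/i≤))) (m/n*n≤m k i)
  where
  1<p : 1 ℕ.< p
  1<p = ℕ.nonTrivial⇒n>1 p {{prime⇒nonTrivial pr}}

open import Data.Nat using (_≤_; _^_; _*_)
open import Data.Nat.Divisibility using (_∣_)

theorem3p3 : (F : FiniteField) → (p : ℕ) → Prime p → HasChar F p →
    (k : ℕ) → 1 ≤ k → (i : ℕ) → (nz : NonZero i) → i ≤ k →
    (j : ℕ) → (∀ t → _/_ k i {{nz}} ≤ p ^ t → j ≤ t) →
    (d : ℕ) → d ∣ (FiniteField.size F ^ i ∸ 1) →
    InP F k (p ^ j * d)
theorem3p3 F p pr p≈0 k _ i nz i≤k j j≤ d d∣ =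
  let s , 0<s , s≤pʲ , minimal , s*i≤k = exponent pr k i {{nz}} i≤k j j≤
      e , v , 0<e , irr , v∣ , order = PrimitiveFactor.primitiveFactor F 0<d d⁻¹
      e≤i = DegreeBound.degree≤ F v irr 0<e {i} d∣ v∣ 0<i
      u , f^s≋u = monic-^ v s
      u∣f^s = PT.∣-respʳ (≋-sym f^s≋u) PT.∣-refl
      f^s∣u = PT.∣-respʳ f^s≋u PT.∣-refl
  in Realisation.order∈P F u
       (ℕₚ.*-mono-< 0<s 0<e)
       (ℕₚ.≤-trans (ℕₚ.*-monoʳ-≤ s e≤i) s*i≤k)
       (ℕₚ.*-mono-< (ℕₚ.m^n>0 p {{prime⇒nonZero pr}} j) 0<d)
       (PT.∣-trans u∣f^s (f^∣ v 0<e v∣ order d≉0 {s} {j} s≤pʲ))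
       (λ m 0<m u∣ → f^-order v 0<e v∣ order d≉0 {s} {j} 0<s minimal m 0<m (PT.∣-trans f^s∣u u∣))
  where
  open FiniteField F using (size; inverse; trans; *-comm)
  open FieldPolynomials F using (module PT; ≋-sym; monic-^)
  open DegreeBound F using (1<size)
  open PeriodOfPower F pr p≈0 using (f^∣; f^-order; ∣size^-1⇒·1≉0)
  0<i : 0 ℕ.< i
  0<i = ℕ.>-nonZero⁻¹ i {{nz}}
  1<size^i : 1 ℕ.< size ℕ.^ i
  1<size^i = ℕₚ.^-monoʳ-< size 1<size 0<i
  0<d : 0 ℕ.< d
  -- 0 divides only 0, and q^i - 1 is positive.
  0<d = ℕₚ.n≢0⇒n>0 λ { ≡.refl → ℕₚ.<⇒≢ (ℕₚ.m<n⇒0<n∸m 1<size^i) (≡.sym (ℕ∣.0∣⇒≡0 d∣)) }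
  d≉0 = ∣size^-1⇒·1≉0 0<i d∣
  d⁻¹ = let u , eq = inverse _ d≉0 in u , trans (*-comm _ _) eq
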